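{- Let $G$ be a graph of order $n$ realizing the set $S_{\{i,j\}_{n}^{2}}$, where $0<i<j\leqslant n$ and $2\notin\{i,j\}$. If $i>1$, then $j>n-3$.
   Context: For a simple graph $G$, its Laplacian spectrum is the multiset of eigenvalues of $L(G)=D-A$. For integers $0<i<j\leqslant n$ and $m\in\{1,\dots,n\}\setminus\{i,j\}$, $S_{\{i,j\}_{n}^{m}}$ denotes the multiset $\{0,1,\ldots,m-1,m,m,m+1,\ldots,n\}\setminus\{i,j\}$. A graph realizes a multiset $S$ if it is simple, connected, and its Laplacian spectrum (with multiplicities) equals $S$. -}

module Defs where

open import Data.Bool using (Bool; true; false; if_then_else_; _∨_)
open import Data.Nat as ℕ using (ℕ; zero; suc; _≡ᵇ_)
open import Data.Integer as ℤ using (ℤ; +_; -_; -1ℤ; 0ℤ; 1ℤ)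
open import Data.Fin using (Fin; zero; suc; punchIn; toℕ)
open import Data.Fin.Properties using (_≟_)
open import Data.List using (List; []; _∷_; map; foldr; upTo; concatMap; allFin)
open import Relation.Binary.PropositionalEquality using (_≡_)
open import Relation.Nullary using (¬_; does)
open import Data.Product using (_×_)

record Graph (n : ℕ) : Set where
  field
    adj    : Fin n → Fin n → Bool
    sym    : ∀ u v → adj u v ≡ adj v u
    irrefl : ∀ u → adj u u ≡ false
open Graph public

data Walk {n : ℕ} (G : Graph n) : Fin n → Fin n → Set where
  here : ∀ {u} → Walk G u u
  step : ∀ {u w v} → adj G u w ≡ true → Walk G w v → Walk G u v

Connected : ∀ {n} → Graph n → Set
Connected {n} G = ∀ (u v : Fin n) → Walk G u v

degree : ∀ {n} → Graph n → Fin n → ℕ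
degree {n} G u = foldr (λ v acc → if adj G u v then suc acc else acc) 0 (allFin n)

laplacian : ∀ {n} → Graph n → Fin n → Fin n → ℤ
laplacian G u v =
  if does (u ≟ v) then + degree G u
  else (if adj G u v then -1ℤ else 0ℤ)

-- Integer polynomials as coefficient lists (constant term first)

Poly : Set
Poly = List ℤ

infixl 6 _+ₚ_
infixl 7 _*ₚ_

_+ₚ_ : Poly → Poly → Poly
[]      +ₚ q       = q
(a ∷ p) +ₚ []      = a ∷ p
(a ∷ p) +ₚ (b ∷ q) = (a ℤ.+ b) ∷ (p +ₚ q)

scaleₚ : ℤ → Poly → Poly
scaleₚ c = map (c ℤ.*_)

_*ₚ_ : Poly → Poly → Poly
[]      *ₚ q = []
(a ∷ p) *ₚ q = scaleₚ a q +ₚ (0ℤ ∷ (p *ₚ q))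

constₚ : ℤ → Poly
constₚ c = c ∷ []

Xₚ : Poly
Xₚ = 0ℤ ∷ 1ℤ ∷ []

coeff : Poly → ℕ → ℤ
coeff []      k       = 0ℤ
coeff (a ∷ p) zero    = a
coeff (a ∷ p) (suc k) = coeff p k

-- equality of polynomials (insensitive to trailing zero coefficients)
_≈ₚ_ : Poly → Poly → Set
p ≈ₚ q = ∀ k → coeff p k ≡ coeff q k

det : (n : ℕ) → (Fin n → Fin n → Poly) → Poly
det zero    M = constₚ 1ℤ
det (suc n) M = go (suc n) M
  where
  sign : ℕ → ℤ
  sign zero          = 1ℤ
  sign (suc zero)    = -1ℤ
  sign (suc (suc k)) = sign k
  go : (m : ℕ) → (Fin m → Fin m → Poly) → Poly
  go zero    N = constₚ 1ℤ
  go (suc m) N = foldr _+ₚ_ []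
    (map (λ j → scaleₚ (sign (toℕ j)) (N zero j *ₚ go m (λ r c → N (suc r) (punchIn j c))))
         (allFin (suc m)))

charPoly : ∀ {n} → (Fin n → Fin n → ℤ) → Poly
charPoly {n} M = det n (λ u v →
  (if does (u ≟ v) then Xₚ else []) +ₚ constₚ (ℤ.- M u v))

-- Multisets S_{{i,j}_n^m} = {0,1,...,m-1,m,m,m+1,...,n} \ {i,j}, as a list

S : (n i j m : ℕ) → List ℕ
S n i j m = concatMap pick (upTo (suc n))
  where
  pick : ℕ → List ℕ
  pick k = if (k ≡ᵇ i) ∨ (k ≡ᵇ j) then []
           else (if k ≡ᵇ m then k ∷ k ∷ [] else k ∷ [])

rootsPoly : List ℕ → Poly
rootsPoly = foldr (λ s acc → (Xₚ +ₚ constₚ (ℤ.- (+ s))) *ₚ acc) (constₚ 1ℤ)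

LaplacianSpectrumIs : ∀ {n} → Graph n → List ℕ → Set
LaplacianSpectrumIs G s = charPoly (laplacian G) ≈ₚ rootsPoly s

Realizes : ∀ {n} → Graph n → List ℕ → Set
Realizes G s = Connected G × LaplacianSpectrumIs G s

{-# OPTIONS --safe #-}
module Submission where

-- Suppose j ≤ n - 3, so that n, n - 1, n - 2, 1 and 2 (twice) are eigenvalues of G.
-- On a graph with N vertices, complementing replaces an eigenvalue μ, with eigenvector
-- orthogonal to 1, by N - μ. If N - 1 is an eigenvalue of a disconnected graph, then one
-- component has at least N - 1 vertices, so some vertex is isolated; all eigenvectors with
-- nonzero eigenvalue vanish there and it can be deleted. Starting from the complement of G,
-- alternately delete an isolated vertex and complement. In the three deletions the zero
-- eigenvalue comes from n, 1, n - 1 and the large one from 1, n - 1, 2. On the remaining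
-- n - 3 vertices the eigenvectors of G for 2 have become harmonic, and n - 2 has become the
-- large eigenvalue n - 4: there are at most two components, one of them a single vertex, so
-- the eigenvalue 2 of G is simple. Since the Laplacian is symmetric, this contradicts the
-- double root of its characteristic polynomial.

open import Defs hiding (sym)
open import Data.Bool using (Bool; true; false; if_then_else_; not; T)
open import Data.Empty using (⊥)
open import Data.Fin using (Fin; zero; suc; punchIn; punchOut)
open import Data.Fin.Properties as Fin using (any?; punchInᵢ≢i; punchIn-punchOut)
open import Data.Integer
  using (ℤ; +_; +0; +[1+_]; -[1+_]; 0ℤ; 1ℤ; -1ℤ; -_; _+_; _-_; _*_; _≤_; _<_; +≤+; ∣_∣; positive; ≢-nonZero)
open import Data.Integer.Properties
open import Data.Integer.Tactic.RingSolver using (solve-∀)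
open import Data.List as List using (List; []; _∷_; _++_; allFin; tabulate; concatMap; upTo)
open import Data.List.Membership.Propositional using (_∈_)
open import Data.List.Membership.Propositional.Properties using (∈-upTo⁺)
open import Data.List.Properties using (map-cong)
open import Data.List.Relation.Unary.Any using (here; there)
open import Data.Nat as ℕ using (ℕ; zero; suc; _≡ᵇ_)
import Data.Nat.Properties as ℕ
open import Data.Product using (∃; _×_; _,_)
open import Data.Sum using (inj₁; inj₂)
open import Data.Unit using (tt)
open import Data.Vec.Functional using (updateAt) renaming (_∷_ to _∷ᵛ_)
open import Data.Vec.Functional.Properties
  using (map-updateAt; updateAt-updates; updateAt-minimal; updateAt-id-local; updateAt-commutes)
open import Function using (const; _∘_; id)
open import Relation.Binary.PropositionalEquality
open import Relation.Nullary using (yes; no; contradiction; does; ¬?; decidable-stable)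
open import Algebra.Properties.Semiring.Sum +-*-semiring
  using (sum; sum-cong-≗; sum-replicate-zero; sum-remove; ∑-distrib-+; ∑-comm; *-distribˡ-sum)

-- Sums over Fin n

sum-zero : ∀ {n} {f : Fin n → ℤ} → (∀ i → f i ≡ 0ℤ) → sum f ≡ 0ℤ
sum-zero {n} f≡0 = trans (sum-cong-≗ f≡0) (sum-replicate-zero n)

sum-linear : ∀ {n} a {f g h : Fin n → ℤ} → (∀ i → h i ≡ a * f i + g i) → sum h ≡ a * sum f + sum g
sum-linear a {f} {g} h≡ =
  trans (sum-cong-≗ h≡) (trans (∑-distrib-+ (λ i → a * f i) g) (cong (_+ sum g) (sym (*-distribˡ-sum a f))))

sum-minus : ∀ {n} (f g : Fin n → ℤ) → sum (λ i → f i - g i) ≡ sum f - sum g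
sum-minus f g = trans (sum-linear -1ℤ {g} {f} (λ i → e (f i) (g i))) (sym (e (sum f) (sum g)))
  where
  e : ∀ x y → x - y ≡ -1ℤ * y + x
  e = solve-∀

sum-const : ∀ n c → sum {n} (λ _ → c) ≡ + n * c
sum-const zero    c = sym (*-zeroˡ c)
sum-const (suc n) c = trans (cong (λ t → c + t) (sum-const n c)) (e (+ n) c)
  where
  e : ∀ x c → c + x * c ≡ (1ℤ + x) * c
  e = solve-∀

sum-mono : ∀ {n} {f g : Fin n → ℤ} → (∀ i → f i ≤ g i) → sum f ≤ sum g
sum-mono {zero}  f≤g = ≤-refl
sum-mono {suc n} f≤g = +-mono-≤ (f≤g zero) (sum-mono (λ i → f≤g (suc i)))

sum-nonNeg : ∀ {n} {f : Fin n → ℤ} → (∀ i → 0ℤ ≤ f i) → 0ℤ ≤ sum f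
sum-nonNeg {n} {f} 0≤f = subst (_≤ sum f) (sum-replicate-zero n) (sum-mono 0≤f)

nonNeg+nonNeg≤0 : ∀ {x y} → 0ℤ ≤ x → 0ℤ ≤ y → x + y ≤ 0ℤ → x ≡ 0ℤ × y ≡ 0ℤ
nonNeg+nonNeg≤0 {x} {y} 0≤x 0≤y x+y≤0 =
  ≤-antisym (≤-trans (subst (_≤ x + y) (+-identityʳ x) (+-monoʳ-≤ x 0≤y)) x+y≤0) 0≤x ,
  ≤-antisym (≤-trans (subst (_≤ x + y) (+-identityˡ y) (+-monoˡ-≤ y 0≤x)) x+y≤0) 0≤y

sum-nonNeg≤0 : ∀ {n} {f : Fin n → ℤ} → (∀ i → 0ℤ ≤ f i) → sum f ≤ 0ℤ → ∀ i → f i ≡ 0ℤ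
sum-nonNeg≤0 {suc n} {f} 0≤f s≤0 i with nonNeg+nonNeg≤0 (0≤f zero) (sum-nonNeg (λ j → 0≤f (suc j))) s≤0
sum-nonNeg≤0 {suc n} 0≤f s≤0 zero    | p , _ = p
sum-nonNeg≤0 {suc n} 0≤f s≤0 (suc i) | _ , q = sum-nonNeg≤0 (λ j → 0≤f (suc j)) (≤-reflexive q) i

≡-neg⇒≡0 : ∀ {x} → x ≡ - x → x ≡ 0ℤ
≡-neg⇒≡0 { +0} _ = refl
≡-neg⇒≡0 { +[1+ _ ]} ()
≡-neg⇒≡0 { -[1+ _ ]} ()

sum-neg : ∀ {n} {f g : Fin n → ℤ} → (∀ i → f i ≡ - g i) → sum f ≡ - sum g
sum-neg {n} {f} {g} f≡-g = trans (sum-linear -1ℤ {g} {λ _ → 0ℤ} (λ i → trans (f≡-g i) (e (g i))))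
  (trans (cong (λ t → -1ℤ * sum g + t) (sum-replicate-zero n)) (sym (e (sum g))))
  where
  e : ∀ x → - x ≡ -1ℤ * x + 0ℤ
  e = solve-∀

-- Exchanging the two summations equates the double sum with its own negative, and zero is the only
-- such integer. Sums over oriented edges cancel in this way later on.
sum-antisym : ∀ {n} (f : Fin n → Fin n → ℤ) → (∀ i j → f i j ≡ - f j i) →
              sum (λ i → sum (f i)) ≡ 0ℤ
sum-antisym f anti = ≡-neg⇒≡0 (trans (sum-neg {g = λ i → sum (λ j → f j i)} (λ i → sum-neg (anti i)))
  (cong -_ (∑-comm (λ i j → f j i))))

sum-single : ∀ {n} (k : Fin n) (f : Fin n → ℤ) → (∀ i → i ≢ k → f i ≡ 0ℤ) → sum f ≡ f k
sum-single {suc n} k f f≡0 =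
  trans (sum-remove {i = k} f)
    (trans (cong (λ t → f k + t) (sum-zero (λ i → f≡0 (punchIn k i) (punchInᵢ≢i k i)))) (+-identityʳ (f k)))

*-cancel-≢0 : ∀ {x y} → x ≢ 0ℤ → x * y ≡ 0ℤ → y ≡ 0ℤ
*-cancel-≢0 {x} x≢0 xy≡0 with i*j≡0⇒i≡0∨j≡0 x xy≡0
... | inj₁ x≡0 = contradiction x≡0 x≢0
... | inj₂ y≡0 = y≡0

-- Determinants of integer matrices

Row : ℕ → Set
Row n = Fin n → ℤ

Matrix : ℕ → Set
Matrix n = Fin n → Row n

alt : ∀ {n} → Fin n → ℤ
alt zero    = 1ℤ
alt (suc i) = - alt i

minor : ∀ {n} → Matrix (suc n) → Fin (suc n) → Matrix n
minor M j r c = M (suc r) (punchIn j c)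

∣_∣ᴹ : ∀ {n} → Matrix n → ℤ
∣_∣ᴹ {zero}  M = 1ℤ
∣_∣ᴹ {suc n} M = sum (λ j → alt j * (M zero j * ∣ minor M j ∣ᴹ))

infixl 9 _[_≔_]
_[_≔_] : ∀ {m n} → (Fin m → Row n) → Fin m → Row n → Fin m → Row n
M [ k ≔ v ] = updateAt M k (const v)

minor-≔ : ∀ {n} (M : Matrix (suc n)) j k v r c →
          minor (M [ suc k ≔ v ]) j r c ≡ (minor M j [ k ≔ v ∘ punchIn j ]) r c
minor-≔ M j k v r c =
  cong (λ w → w c) (map-updateAt {f = _∘ punchIn j} (λ _ → refl) (λ i → M (suc i)) k r)

det-cong : ∀ {n} {M N : Matrix n} → (∀ r c → M r c ≡ N r c) → ∣ M ∣ᴹ ≡ ∣ N ∣ᴹ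
det-cong {zero}  M≡N = refl
det-cong {suc n} M≡N = sum-cong-≗ (λ j → cong (alt j *_)
  (cong₂ _*_ (M≡N zero j) (det-cong (λ r c → M≡N (suc r) (punchIn j c)))))

-- Additivity and homogeneity are packed into one law; at zero rows with `a = -1ℤ` it also makes the
-- determinant vanish when a row is zero.
det-linear : ∀ {n} (M : Matrix n) k a x y →
  ∣ M [ k ≔ (λ c → a * x c + y c) ] ∣ᴹ ≡ a * ∣ M [ k ≔ x ] ∣ᴹ + ∣ M [ k ≔ y ] ∣ᴹ
det-linear {suc n} M zero a x y = sum-linear a (λ j → e a (alt j) (x j) (y j) ∣ minor M j ∣ᴹ)
  where
  e : ∀ a s x y m → s * ((a * x + y) * m) ≡ a * (s * (x * m)) + s * (y * m)
  e = solve-∀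
det-linear {suc n} M (suc k) a x y = sum-linear a (λ j → trans
  (cong (λ d → alt j * (M zero j * d)) (trans (det-cong (minor-≔ M j k (λ c → a * x c + y c)))
    (trans (det-linear (minor M j) k a (x ∘ punchIn j) (y ∘ punchIn j))
      (sym (cong₂ (λ p q → a * p + q) (det-cong (minor-≔ M j k x)) (det-cong (minor-≔ M j k y)))))))
  (e a (alt j) (M zero j) ∣ minor (M [ suc k ≔ x ]) j ∣ᴹ ∣ minor (M [ suc k ≔ y ]) j ∣ᴹ))
  where
  e : ∀ a s m d d′ → s * (m * (a * d + d′)) ≡ a * (s * (m * d)) + s * (m * d′)
  e = solve-∀

-- The ordered pairs (j , punchIn j k) of distinct elements are swapped by
-- (j , k) ↦ (punchIn j k , swapped j k).
swapped : ∀ {n} → Fin (suc n) → Fin n → Fin n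
swapped {suc n} zero    k       = zero
swapped {suc n} (suc j) zero    = j
swapped {suc n} (suc j) (suc k) = suc (swapped j k)

-- The swap reverses signs and has no fixed pair. Pairs `(zero , k)` cancel against
-- `(suc k , zero)`; the others are handled by induction.
sum-swapped : ∀ n (f : Fin (suc n) → Fin n → ℤ) →
              (∀ j k → f j k ≡ - f (punchIn j k) (swapped j k)) →
              sum (λ j → sum (f j)) ≡ 0ℤ
sum-swapped zero    f anti = refl
sum-swapped (suc n) f anti = begin
  sum (f zero) + sum (λ j → f (suc j) zero + sum (λ k → f (suc j) (suc k)))
    ≡⟨ cong (λ t → sum (f zero) + t) (∑-distrib-+ (λ j → f (suc j) zero) (λ j → sum (λ k → f (suc j) (suc k)))) ⟩
  sum (f zero) + (sum (λ j → f (suc j) zero) + sum (λ j → sum (λ k → f (suc j) (suc k))))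
    ≡⟨ cong₂ (λ p q → p + (sum (λ j → f (suc j) zero) + q)) (sum-neg (anti zero))
        (sum-swapped n (λ j k → f (suc j) (suc k)) (λ j k → anti (suc j) (suc k))) ⟩
  - sum (λ j → f (suc j) zero) + (sum (λ j → f (suc j) zero) + 0ℤ)
    ≡⟨ e (sum (λ j → f (suc j) zero)) ⟩
  0ℤ ∎
  where
  open ≡-Reasoning
  e : ∀ s → - s + (s + 0ℤ) ≡ 0ℤ
  e = solve-∀

punchIn-swapped : ∀ {n} (j : Fin (suc n)) k → punchIn (punchIn j k) (swapped j k) ≡ j
punchIn-swapped {suc n} zero    k       = refl
punchIn-swapped {suc n} (suc j) zero    = refl
punchIn-swapped {suc n} (suc j) (suc k) = cong suc (punchIn-swapped j k)

punchIn-punchIn-swapped : ∀ {n} (j : Fin (suc (suc n))) k c →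
  punchIn j (punchIn k c) ≡ punchIn (punchIn j k) (punchIn (swapped j k) c)
punchIn-punchIn-swapped zero    k       c       = refl
punchIn-punchIn-swapped (suc j) zero    c       = refl
punchIn-punchIn-swapped (suc j) (suc k) zero    = refl
punchIn-punchIn-swapped (suc j) (suc k) (suc c) = cong suc (punchIn-punchIn-swapped j k c)

-- The swap turns `(j , k)` into `(k + 1 , j)` if `j ≤ k` and into `(k , j - 1)` otherwise, so the
-- sum of the two indices changes parity.
alt-swapped : ∀ {n} (j : Fin (suc n)) k → alt j * alt k ≡ - (alt (punchIn j k) * alt (swapped j k))
alt-swapped {suc n} zero    k       = e (alt k)
  where
  e : ∀ x → 1ℤ * x ≡ - ((- x) * 1ℤ)
  e = solve-∀
alt-swapped {suc n} (suc j) zero    = e (alt j)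
  where
  e : ∀ x → (- x) * 1ℤ ≡ - (1ℤ * x)
  e = solve-∀
alt-swapped {suc n} (suc j) (suc k) = trans (e (alt j) (alt k)) (trans (alt-swapped j k)
  (cong -_ (sym (e (alt (punchIn j k)) (alt (swapped j k))))))
  where
  e : ∀ x y → (- x) * (- y) ≡ x * y
  e = solve-∀

-- Expansion along the first two rows gives one term for each ordered pair of distinct columns. When
-- the rows agree, exchanging the two columns only reverses the sign.
det-adjacent : ∀ {n} (M : Matrix (suc (suc n))) → (∀ c → M zero c ≡ M (suc zero) c) → ∣ M ∣ᴹ ≡ 0ℤ
det-adjacent {n} M M₀≡M₁ = trans
  (sum-cong-≗ (λ j → trans (cong (alt j *_) (*-distribˡ-sum (M zero j) (λ k → alt k * (M (suc zero) (punchIn j k) * m j k))))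
                            (*-distribˡ-sum (alt j) (λ k → M zero j * (alt k * (M (suc zero) (punchIn j k) * m j k))))))
  (sum-swapped (suc n) f anti)
  where
  m : Fin (suc (suc n)) → Fin (suc n) → ℤ
  m j k = ∣ minor (minor M j) k ∣ᴹ
  f : Fin (suc (suc n)) → Fin (suc n) → ℤ
  f j k = alt j * (M zero j * (alt k * (M (suc zero) (punchIn j k) * m j k)))
  e : ∀ s x t y z → s * (x * (t * (y * z))) ≡ (s * t) * ((x * y) * z)
  e = solve-∀
  e′ : ∀ s x y z → (- s) * ((x * y) * z) ≡ - (s * ((y * x) * z))
  e′ = solve-∀
  anti : ∀ j k → f j k ≡ - f (punchIn j k) (swapped j k)
  anti j k = begin
    f j k ≡⟨ e (alt j) (M zero j) (alt k) (M (suc zero) j′) (m j k) ⟩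
    (alt j * alt k) * ((M zero j * M (suc zero) j′) * m j k)
      ≡⟨ cong₂ _*_ (alt-swapped j k) (cong₂ _*_
           (cong₂ _*_ (trans (M₀≡M₁ j) (cong (M (suc zero)) (sym (punchIn-swapped j k)))) (sym (M₀≡M₁ j′)))
           (det-cong (λ r c → cong (M (suc (suc r))) (punchIn-punchIn-swapped j k c)))) ⟩
    (- (alt j′ * alt k′)) * ((M (suc zero) (punchIn j′ k′) * M zero j′) * m j′ k′)
      ≡⟨ e′ (alt j′ * alt k′) (M (suc zero) (punchIn j′ k′)) (M zero j′) (m j′ k′) ⟩
    - ((alt j′ * alt k′) * ((M zero j′ * M (suc zero) (punchIn j′ k′)) * m j′ k′))
      ≡⟨ cong -_ (sym (e (alt j′) (M zero j′) (alt k′) (M (suc zero) (punchIn j′ k′)) (m j′ k′))) ⟩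
    - f j′ k′ ∎
    where
    open ≡-Reasoning
    j′ = punchIn j k
    k′ = swapped j k

det-minors≡0 : ∀ {n} (M : Matrix (suc n)) → (∀ j → ∣ minor M j ∣ᴹ ≡ 0ℤ) → ∣ M ∣ᴹ ≡ 0ℤ
det-minors≡0 M m≡0 = sum-zero (λ j → trans (cong (λ d → alt j * (M zero j * d)) (m≡0 j)) (e (alt j) (M zero j)))
  where
  e : ∀ x y → x * (y * 0ℤ) ≡ 0ℤ
  e = solve-∀

-- When rows 0 and b + 2 agree, expand the determinant bilinearly at rows 1 and b + 2,
-- both set to their sum.
det-first≡ : ∀ {n} (M : Matrix (suc n)) b → (∀ c → M zero c ≡ M (suc b) c) → ∣ M ∣ᴹ ≡ 0ℤ
det-first≡ {suc n} M zero    M₀≡ = det-adjacent M M₀≡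
det-first≡ {suc n} M (suc b) M₀≡ = begin
  ∣ M ∣ᴹ                              ≡⟨ det-cong M≡N ⟩
  ∣ N x v ∣ᴹ                          ≡⟨ e ∣ N x x ∣ᴹ ∣ N x v ∣ᴹ ∣ N v x ∣ᴹ ∣ N v v ∣ᴹ ⟩
  (1ℤ * (1ℤ * ∣ N x x ∣ᴹ + ∣ N x v ∣ᴹ) + (1ℤ * ∣ N v x ∣ᴹ + ∣ N v v ∣ᴹ)) - ∣ N x x ∣ᴹ - ∣ N v x ∣ᴹ - ∣ N v v ∣ᴹ
    ≡⟨ cong₂ (λ p q → p - q - ∣ N v x ∣ᴹ - ∣ N v v ∣ᴹ) (trans (sym split) (N-same x+v)) (N-same x) ⟩
  0ℤ - 0ℤ - ∣ N v x ∣ᴹ - ∣ N v v ∣ᴹ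
    ≡⟨ cong₂ (λ p q → 0ℤ - 0ℤ - p - q) (N-first x) (N-first v) ⟩
  0ℤ ∎
  where
  open ≡-Reasoning
  k = suc (suc b)
  x v x+v : Row (suc (suc n))
  x = M (suc zero)
  v = M zero
  x+v c = 1ℤ * x c + v c
  N : Row (suc (suc n)) → Row (suc (suc n)) → Matrix (suc (suc n))
  N y z = M [ k ≔ z ] [ suc zero ≔ y ]
  N-comm : ∀ y z r c → N y z r c ≡ (M [ suc zero ≔ y ] [ k ≔ z ]) r c
  N-comm y z r c = cong (λ w → w c) (updateAt-commutes (suc zero) k (λ ()) M r)
  M≡N : ∀ r c → M r c ≡ N x v r c
  M≡N zero          c = refl
  M≡N (suc zero)    c = refl
  M≡N (suc (suc r)) c with r Fin.≟ b
  ... | yes refl = trans (sym (M₀≡ c)) (cong (λ w → w c) (sym (updateAt-updates b (λ i → M (suc (suc i))))))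
  ... | no  r≢b  = cong (λ w → w c) (sym (updateAt-minimal r b (λ i → M (suc (suc i))) r≢b))
  -- Expanding along row 0 makes row 1 the first row of each minor, so the claim for smaller
  -- matrices applies.
  N-same : ∀ y → ∣ N y y ∣ᴹ ≡ 0ℤ
  N-same y = det-minors≡0 (N y y) (λ j → det-first≡ (minor (N y y) j) b
    (λ c → cong (λ w → w (punchIn j c)) (sym (updateAt-updates b (λ i → M (suc (suc i)))))))
  N-first : ∀ z → ∣ N v z ∣ᴹ ≡ 0ℤ
  N-first z = det-adjacent (N v z) (λ _ → refl)
  N-linearʳ : ∀ y → ∣ N y x+v ∣ᴹ ≡ 1ℤ * ∣ N y x ∣ᴹ + ∣ N y v ∣ᴹ
  N-linearʳ y = trans (det-cong (N-comm y x+v)) (trans (det-linear (M [ suc zero ≔ y ]) k 1ℤ x v)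
    (sym (cong₂ (λ p q → 1ℤ * p + q) (det-cong (N-comm y x)) (det-cong (N-comm y v)))))
  split : ∣ N x+v x+v ∣ᴹ ≡ 1ℤ * (1ℤ * ∣ N x x ∣ᴹ + ∣ N x v ∣ᴹ) + (1ℤ * ∣ N v x ∣ᴹ + ∣ N v v ∣ᴹ)
  split = trans (det-linear (M [ k ≔ x+v ]) (suc zero) 1ℤ x v)
    (cong₂ (λ p q → 1ℤ * p + q) (N-linearʳ x) (N-linearʳ v))
  e : ∀ a b c d → b ≡ (1ℤ * (1ℤ * a + b) + (1ℤ * c + d)) - a - c - d
  e = solve-∀

det-alternating : ∀ {n} (M : Matrix n) {a b} → a ≢ b → (∀ c → M a c ≡ M b c) → ∣ M ∣ᴹ ≡ 0ℤ
det-alternating {suc n} M {zero}  {zero}  a≢b eq = contradiction refl a≢b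
det-alternating {suc n} M {zero}  {suc b} a≢b eq = det-first≡ M b eq
det-alternating {suc n} M {suc a} {zero}  a≢b eq = det-first≡ M a (λ c → sym (eq c))
det-alternating {suc n} M {suc a} {suc b} a≢b eq =
  det-minors≡0 M (λ j → det-alternating (minor M j) (a≢b ∘ cong suc) (λ c → eq (punchIn j c)))

≔-updates : ∀ {m n} (M : Fin m → Row n) k v c → (M [ k ≔ v ]) k c ≡ v c
≔-updates M k v c = cong (λ w → w c) (updateAt-updates k M)

≔-minimal : ∀ {m n} (M : Fin m → Row n) {r k} v c → r ≢ k → (M [ k ≔ v ]) r c ≡ M r c
≔-minimal M {r} {k} v c r≢k = cong (λ w → w c) (updateAt-minimal r k M r≢k)

≔-cong : ∀ {m n} {M N : Fin m → Row n} k {v w} → (∀ r c → M r c ≡ N r c) → (∀ c → v c ≡ w c) →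
         ∀ r c → (M [ k ≔ v ]) r c ≡ (N [ k ≔ w ]) r c
≔-cong {M = M} {N} k {v} {w} M≡N v≡w r c with r Fin.≟ k
... | yes refl = trans (≔-updates M k v c) (trans (v≡w c) (sym (≔-updates N k w c)))
... | no r≢k   = trans (≔-minimal M v c r≢k) (trans (M≡N r c) (sym (≔-minimal N w c r≢k)))

≔-id : ∀ {m n} (M : Fin m → Row n) k r c → (M [ k ≔ M k ]) r c ≡ M r c
≔-id M k r c = cong (λ w → w c) (updateAt-id-local k M refl r)

-- Gaussian elimination against a row v, for an arbitrary row-multilinear form
-- that vanishes as soon as one of its arguments is v.
module _ {n} (p : ℤ) (v : Row n) where

  eliminate : ∀ {m} → (Fin m → ℤ) → (Fin m → Row n) → Fin m → Row n
  eliminate a X r c = p * X r c + a r * v c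

  eliminate-≡0 : ∀ m (F : (Fin m → Row n) → ℤ) →
    (∀ {X Y} → (∀ r c → X r c ≡ Y r c) → F X ≡ F Y) →
    (∀ X k a x y → F (X [ k ≔ (λ c → a * x c + y c) ]) ≡ a * F (X [ k ≔ x ]) + F (X [ k ≔ y ])) →
    (∀ X k → (∀ c → X k c ≡ v c) → F X ≡ 0ℤ) →
    ∀ a X → F X ≡ 0ℤ → F (eliminate a X) ≡ 0ℤ
  eliminate-≡0 zero F cong-F lin van a X FX≡0 = trans (cong-F (λ ())) FX≡0
  eliminate-≡0 (suc m) F cong-F lin van a X FX≡0 = begin
    F (eliminate a X)
      ≡⟨ cong-F (λ { zero c → refl ; (suc r) c → refl }) ⟩
    F (Y [ zero ≔ (λ c → p * X zero c + a zero * v c) ])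
      ≡⟨ lin Y zero p (X zero) (λ c → a zero * v c) ⟩
    p * F (Y [ zero ≔ X zero ]) + F (Y [ zero ≔ (λ c → a zero * v c) ])
      ≡⟨ cong₂ (λ s t → p * s + t)
           (trans (cong-F (λ { zero c → refl ; (suc r) c → refl })) tail≡0)
           (trans (cong-F (λ { zero c → sym (+-identityʳ (a zero * v c)) ; (suc r) c → refl }))
             (trans (lin Y zero (a zero) v (λ _ → 0ℤ))
               (cong₂ (λ s t → a zero * s + t) (van (Y [ zero ≔ v ]) zero (λ _ → refl)) zero-row))) ⟩
    p * 0ℤ + (a zero * 0ℤ + 0ℤ)
      ≡⟨ e p (a zero) ⟩
    0ℤ ∎
    where
    open ≡-Reasoning
    Y : Fin (suc m) → Row n
    Y = X zero ∷ᵛ eliminate (a ∘ suc) (X ∘ suc)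
    e : ∀ p q → p * 0ℤ + (q * 0ℤ + 0ℤ) ≡ 0ℤ
    e = solve-∀
    e₁ : ∀ x → -1ℤ * x + x ≡ 0ℤ
    e₁ = solve-∀
    zero-row : F (Y [ zero ≔ (λ _ → 0ℤ) ]) ≡ 0ℤ
    zero-row = trans (lin Y zero -1ℤ (λ _ → 0ℤ) (λ _ → 0ℤ)) (e₁ (F (Y [ zero ≔ (λ _ → 0ℤ) ])))
    -- With the first row frozen, `F` is again a multilinear form in the remaining rows that
    -- vanishes at `v`; this is the induction on `m`.
    tail≡0 : F Y ≡ 0ℤ
    tail≡0 = eliminate-≡0 m (λ Z → F (X zero ∷ᵛ Z))
      (λ Z≡ → cong-F (λ { zero c → refl ; (suc r) c → Z≡ r c }))
      (λ Z k a x y → trans (cong-F (cons-≔ Z k (λ c → a * x c + y c)))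
        (trans (lin (X zero ∷ᵛ Z) (suc k) a x y)
          (sym (cong₂ (λ s t → a * s + t) (cong-F (cons-≔ Z k x)) (cong-F (cons-≔ Z k y))))))
      (λ Z k Zk≡v → van (X zero ∷ᵛ Z) (suc k) Zk≡v)
      (a ∘ suc) (X ∘ suc)
      (trans (cong-F (λ { zero c → refl ; (suc r) c → refl })) FX≡0)
      where
      cons-≔ : ∀ Z k w r c → (X zero ∷ᵛ (Z [ k ≔ w ])) r c ≡ ((X zero ∷ᵛ Z) [ suc k ≔ w ]) r c
      cons-≔ Z k w zero    c = refl
      cons-≔ Z k w (suc r) c = refl

-- Kernel vectors of singular integer matrices

infixl 8 _·_
_·_ : ∀ {n} → Row n → Row n → ℤ
x · y = sum (λ c → x c * y c)

NonZeroRow : ∀ {n} → Row n → Set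
NonZeroRow z = ∃ λ c → z c ≢ 0ℤ

·-comm : ∀ {n} (x y : Row n) → x · y ≡ y · x
·-comm x y = sum-cong-≗ (λ c → *-comm (x c) (y c))

·-linearˡ : ∀ {n} a (x y z : Row n) → (λ c → a * x c + y c) · z ≡ a * (x · z) + y · z
·-linearˡ a x y z = sum-linear a (λ c → e a (x c) (y c) (z c))
  where
  e : ∀ a x y z → (a * x + y) * z ≡ a * (x * z) + y * z
  e = solve-∀

·-scaleʳ : ∀ {n} a (x z : Row n) → x · (λ c → a * z c) ≡ a * (x · z)
·-scaleʳ a x z = trans (sum-cong-≗ (λ c → e a (x c) (z c))) (sym (*-distribˡ-sum a (λ c → x c * z c)))
  where
  e : ∀ a x z → x * (a * z) ≡ a * (x * z)
  e = solve-∀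

Kernel : ∀ {n} → Matrix n → Set
Kernel M = ∃ λ z → NonZeroRow z × (∀ r → M r · z ≡ 0ℤ)

det-zero-column : ∀ {n} (M : Matrix (suc n)) → (∀ r → M r zero ≡ 0ℤ) → ∣ M ∣ᴹ ≡ 0ℤ
det-zero-column {n} M M₀≡0 = sum-zero term
  where
  e₁ : ∀ s d → s * (0ℤ * d) ≡ 0ℤ
  e₁ = solve-∀
  e₂ : ∀ s d → s * (d * 0ℤ) ≡ 0ℤ
  e₂ = solve-∀
  term : ∀ j → alt j * (M zero j * ∣ minor M j ∣ᴹ) ≡ 0ℤ
  term zero = trans (cong (λ t → 1ℤ * (t * ∣ minor M zero ∣ᴹ)) (M₀≡0 zero)) (e₁ 1ℤ ∣ minor M zero ∣ᴹ)
  term (suc {suc _} j) = trans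
    (cong (λ t → alt (suc j) * (M zero (suc j) * t)) (det-zero-column (minor M (suc j)) (λ r → M₀≡0 (suc r))))
    (e₂ (alt (suc j)) (M zero (suc j)))

-- Fraction-free Gaussian elimination. A zero first column yields the first unit vector. Otherwise
-- the pivot is made nonzero, if necessary by adding a later row to the first, and `kernel-pivot`
-- reduces the size.
kernel : ∀ {n} (M : Matrix n) → ∣ M ∣ᴹ ≡ 0ℤ → Kernel M

-- Clearing the first column by cross-multiplication with the pivot keeps the determinant zero. Its
-- expansion then consists of `p` times the minor at the pivot, so that minor is singular.
kernel-pivot : ∀ {n} (M : Matrix (suc n)) → M zero zero ≢ 0ℤ → ∣ M ∣ᴹ ≡ 0ℤ → Kernel M
kernel-pivot {n} M p≢0 det≡0 = lift (kernel (minor M′ zero) minor≡0)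
  where
  p = M zero zero
  M′ : Matrix (suc n)
  M′ = M zero ∷ᵛ eliminate p (M zero) (λ r → - M (suc r) zero) (M ∘ suc)
  M′-det≡0 : ∣ M′ ∣ᴹ ≡ 0ℤ
  M′-det≡0 = eliminate-≡0 p (M zero) n (λ X → ∣ M zero ∷ᵛ X ∣ᴹ)
    (λ {X} {Y} X≡Y → det-cong {M = M zero ∷ᵛ X} {M zero ∷ᵛ Y} (λ { zero c → refl ; (suc r) c → X≡Y r c }))
    (λ X k a x y → trans (det-cong (cons-≔ X k (λ c → a * x c + y c)))
      (trans (det-linear (M zero ∷ᵛ X) (suc k) a x y)
        (sym (cong₂ (λ s t → a * s + t) (det-cong (cons-≔ X k x)) (det-cong (cons-≔ X k y))))))
    (λ X k Xk≡ → det-alternating (M zero ∷ᵛ X) {zero} {suc k} (λ ()) (λ c → sym (Xk≡ c)))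
    (λ r → - M (suc r) zero) (M ∘ suc)
    (trans (det-cong {M = M zero ∷ᵛ M ∘ suc} {M} (λ { zero c → refl ; (suc r) c → refl })) det≡0)
    where
    cons-≔ : ∀ (X : Fin n → Row (suc n)) k w r c → (M zero ∷ᵛ (X [ k ≔ w ])) r c ≡ ((M zero ∷ᵛ X) [ suc k ≔ w ]) r c
    cons-≔ X k w zero    c = refl
    cons-≔ X k w (suc r) c = refl
  first-column : ∀ r → M′ (suc r) zero ≡ 0ℤ
  first-column r = e p (M (suc r) zero)
    where
    e : ∀ p x → p * x + (- x) * p ≡ 0ℤ
    e = solve-∀
  minor≡0 : ∣ minor M′ zero ∣ᴹ ≡ 0ℤ
  minor≡0 = *-cancel-≢0 p≢0 (begin
    p * ∣ minor M′ zero ∣ᴹ      ≡⟨ e (p * ∣ minor M′ zero ∣ᴹ) ⟩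
    1ℤ * (p * ∣ minor M′ zero ∣ᴹ) + 0ℤ
      ≡⟨ cong (λ t → 1ℤ * (p * ∣ minor M′ zero ∣ᴹ) + t) (sym (sum-zero (other n M′ first-column))) ⟩
    ∣ M′ ∣ᴹ                     ≡⟨ M′-det≡0 ⟩
    0ℤ ∎)
    where
    open ≡-Reasoning
    e : ∀ x → x ≡ 1ℤ * x + 0ℤ
    e = solve-∀
    e₂ : ∀ s d → s * (d * 0ℤ) ≡ 0ℤ
    e₂ = solve-∀
    other : ∀ n (N : Matrix (suc n)) → (∀ r → N (suc r) zero ≡ 0ℤ) →
            ∀ j → alt (suc j) * (N zero (suc j) * ∣ minor N (suc j) ∣ᴹ) ≡ 0ℤ
    other (suc n) N N₀≡0 j = trans
      (cong (λ t → alt (suc j) * (N zero (suc j) * t)) (det-zero-column (minor N (suc j)) N₀≡0))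
      (e₂ (alt (suc j)) (N zero (suc j)))
  lift : Kernel (minor M′ zero) → Kernel M
  lift (z′ , (c , z′c≢0) , Mz′≡0) = z , (suc c , z′c≢0 ∘ *-cancel-≢0 p≢0) , Mz≡0
    where
    s = (M zero ∘ suc) · z′
    -- Back substitution asks for the first coordinate `- s / p`; the whole vector is multiplied by
    -- `p` to stay integral.
    z : Row (suc n)
    z = - s ∷ᵛ (λ c → p * z′ c)
    Mz≡0 : ∀ r → M r · z ≡ 0ℤ
    Mz≡0 zero = trans (cong (λ t → p * (- s) + t) (·-scaleʳ p (M zero ∘ suc) z′)) (e p s)
      where
      e : ∀ p s → p * (- s) + p * s ≡ 0ℤ
      e = solve-∀
    Mz≡0 (suc r) = begin
      q * (- s) + (M (suc r) ∘ suc) · (λ c → p * z′ c)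
        ≡⟨ cong (λ t → q * (- s) + t) (·-scaleʳ p (M (suc r) ∘ suc) z′) ⟩
      q * (- s) + p * t
        ≡⟨ e p q s t ⟩
      p * t + (- q) * s
        ≡⟨ cong (λ u → p * t + u) (sym (scaleˡ (- q) (M zero ∘ suc))) ⟩
      p * t + (λ c → (- q) * M zero (suc c)) · z′
        ≡⟨ sym (·-linearˡ p (M (suc r) ∘ suc) (λ c → (- q) * M zero (suc c)) z′) ⟩
      (λ c → p * M (suc r) (suc c) + (- q) * M zero (suc c)) · z′
        ≡⟨ Mz′≡0 r ⟩
      0ℤ ∎
      where
      open ≡-Reasoning
      q = M (suc r) zero
      t = (M (suc r) ∘ suc) · z′
      e : ∀ p q s t → q * (- s) + p * t ≡ p * t + (- q) * s
      e = solve-∀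
      scaleˡ : ∀ a x → (λ c → a * x c) · z′ ≡ a * (x · z′)
      scaleˡ a x = trans (·-comm (λ c → a * x c) z′) (trans (·-scaleʳ a z′ x) (cong (a *_) (·-comm z′ x)))

kernel {suc n} M det≡0 with any? (λ r → ¬? (M r zero ≟ 0ℤ))
... | no  none = (1ℤ ∷ᵛ const 0ℤ) , (zero , λ ()) , λ r →
        cong₂ _+_ (trans (*-identityʳ (M r zero)) (decidable-stable (M r zero ≟ 0ℤ) (λ ≢0 → none (r , ≢0))))
                  (sum-zero (λ c → *-zeroʳ (M r (suc c))))
... | yes (r , Mr≢0) with M zero zero ≟ 0ℤ
...   | no  M₀≢0 = kernel-pivot M M₀≢0 det≡0
...   | yes M₀≡0 with r
...     | zero  = contradiction M₀≡0 Mr≢0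
...     | suc k = transport (kernel-pivot M′ (λ eq → Mr≢0 (trans (sym (e₀ (M (suc k) zero))) (trans (cong (λ t → 1ℤ * M (suc k) zero + t) (sym M₀≡0)) eq))) M′-det≡0)
  where
  e₀ : ∀ x → 1ℤ * x + 0ℤ ≡ x
  e₀ = solve-∀
  e₁ : ∀ x y → x ≡ (1ℤ * y + x) - y
  e₁ = solve-∀
  M′ : Matrix (suc n)
  M′ = M [ zero ≔ (λ c → 1ℤ * M (suc k) c + M zero c) ]
  M′-det≡0 : ∣ M′ ∣ᴹ ≡ 0ℤ
  M′-det≡0 = trans (det-linear M zero 1ℤ (M (suc k)) (M zero))
    (cong₂ (λ s t → 1ℤ * s + t)
      (det-alternating (M [ zero ≔ M (suc k) ]) {zero} {suc k} (λ ()) (λ _ → refl))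
      (trans (det-cong (≔-id M zero)) det≡0))
  transport : Kernel M′ → Kernel M
  transport (z , z≢0 , M′z≡0) = z , z≢0 , λ where
    zero    → trans (e₁ (M zero · z) (M (suc k) · z))
                (cong₂ _-_ (trans (sym (·-linearˡ 1ℤ (M (suc k)) (M zero) z)) (M′z≡0 zero)) (M′z≡0 (suc k)))
    (suc r) → M′z≡0 (suc r)

-- Cramer's rule and double roots

det-sum : ∀ {m n} (M : Matrix n) k (a : Fin m → ℤ) (f : Fin m → Row n) →
  ∣ M [ k ≔ (λ c → sum (λ r → a r * f r c)) ] ∣ᴹ ≡ sum (λ r → a r * ∣ M [ k ≔ f r ] ∣ᴹ)
det-sum {zero} M k a f = trans (det-linear M k -1ℤ (const 0ℤ) (const 0ℤ)) (e ∣ M [ k ≔ const 0ℤ ] ∣ᴹ)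
  where
  e : ∀ x → -1ℤ * x + x ≡ 0ℤ
  e = solve-∀
det-sum {suc m} M k a f = trans (det-linear M k (a zero) (f zero) (λ c → sum (λ r → a (suc r) * f (suc r) c)))
  (cong (λ t → a zero * ∣ M [ k ≔ f zero ] ∣ᴹ + t) (det-sum M k (a ∘ suc) (f ∘ suc)))

-- By linearity in row `k`, only the summand `r = k` survives: every other one repeats a row.
cramer : ∀ {n} (M : Matrix n) k (w : Row n) →
  ∣ M [ k ≔ (λ c → sum (λ r → w r * M r c)) ] ∣ᴹ ≡ w k * ∣ M ∣ᴹ
cramer M k w = trans (det-sum M k w M) (trans
  (sum-single k (λ r → w r * ∣ M [ k ≔ M r ] ∣ᴹ) (λ r r≢k → trans
    (cong (w r *_) (det-alternating (M [ k ≔ M r ]) (r≢k ∘ sym)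
      (λ c → trans (≔-updates M k (M r) c) (sym (≔-minimal M (M r) c r≢k)))))
    (*-zeroʳ (w r))))
  (cong (w k *_) (det-cong (≔-id M k))))

infix 4 _≡_mod_
-- Determinants depending on an integer `t` are compared modulo `t`, which stands in for taking
-- constant terms of polynomials in `t`.
data _≡_mod_ (x y t : ℤ) : Set where
  by : ∀ s → x ≡ y + t * s → x ≡ y mod t

+-mod : ∀ {t x x′ y y′} → x ≡ x′ mod t → y ≡ y′ mod t → x + y ≡ x′ + y′ mod t
+-mod {t} {_} {x′} {_} {y′} (by s refl) (by s′ refl) = by (s + s′) (e t x′ y′ s s′)
  where
  e : ∀ t x y s s′ → (x + t * s) + (y + t * s′) ≡ (x + y) + t * (s + s′)
  e = solve-∀

*-mod : ∀ {t x x′ y y′} → x ≡ x′ mod t → y ≡ y′ mod t → x * y ≡ x′ * y′ mod t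
*-mod {t} {_} {x′} {_} {y′} (by s refl) (by s′ refl) = by (x′ * s′ + s * y′ + t * (s * s′)) (e t x′ y′ s s′)
  where
  e : ∀ t x y s s′ → (x + t * s) * (y + t * s′) ≡ x * y + t * (x * s′ + s * y + t * (s * s′))
  e = solve-∀

refl-mod : ∀ {t} x → x ≡ x mod t
refl-mod {t} x = by 0ℤ (e t x)
  where
  e : ∀ t x → x ≡ x + t * 0ℤ
  e = solve-∀

sum-mod : ∀ {t n} {f g : Fin n → ℤ} → (∀ i → f i ≡ g i mod t) → sum f ≡ sum g mod t
sum-mod {n = zero}  f≡g = refl-mod 0ℤ
sum-mod {n = suc n} f≡g = +-mod (f≡g zero) (sum-mod (λ i → f≡g (suc i)))

det-mod : ∀ {t n} {M N : Matrix n} → (∀ r c → M r c ≡ N r c mod t) → ∣ M ∣ᴹ ≡ ∣ N ∣ᴹ mod t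
det-mod {n = zero}  M≡N = refl-mod 1ℤ
det-mod {n = suc n} M≡N = sum-mod (λ j → *-mod (refl-mod (alt j))
  (*-mod (M≡N zero j) (det-mod (λ r c → M≡N (suc r) (punchIn j c)))))

-- A multiple of `1 + ∣ d ∣` with absolute value `∣ d ∣` must be zero.
≡0-of-divisible : ∀ d → (∀ t → t ≢ 0ℤ → ∃ λ s → d ≡ t * s) → d ≡ 0ℤ
≡0-of-divisible d div with div +[1+ ∣ d ∣ ] (λ ())
... | +0       , d≡ = trans d≡ (*-zeroʳ +[1+ ∣ d ∣ ])
... | +[1+ s ] , d≡ = contradiction (trans (cong ∣_∣ d≡) (abs-* +[1+ ∣ d ∣ ] +[1+ s ])) (ℕ.<⇒≢ (ℕ.m≤m*n (suc ∣ d ∣) (suc s)))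
... | -[1+ s ] , d≡ = contradiction (trans (cong ∣_∣ d≡) (abs-* +[1+ ∣ d ∣ ] -[1+ s ])) (ℕ.<⇒≢ (ℕ.m≤m*n (suc ∣ d ∣) (suc s)))

-- The identity matrix; recursion on both indices lets `sum-δ` go by induction.
δ : ∀ {n} → Matrix n
δ zero    zero    = 1ℤ
δ zero    (suc c) = 0ℤ
δ (suc r) zero    = 0ℤ
δ (suc r) (suc c) = δ r c

sum-δ : ∀ {n} (w : Row n) c → sum (λ r → w r * δ r c) ≡ w c
sum-δ w zero    = trans (cong₂ _+_ (*-identityʳ (w zero)) (sum-zero (λ r → *-zeroʳ (w (suc r))))) (+-identityʳ (w zero))
sum-δ w (suc c) = trans (cong₂ _+_ (*-zeroʳ (w zero)) (sum-δ (w ∘ suc) c)) (+-identityˡ (w (suc c)))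

-- If w is a left kernel vector of A, replacing row k of A + t δ by w divides the
-- determinant by t (up to the factor w k), so a double root leaves a singular matrix.
second-kernel-vector : ∀ {n} (A : Matrix n) (w : Row n) → NonZeroRow w →
  (∀ c → sum (λ r → w r * A r c) ≡ 0ℤ) →
  (∀ t → ∃ λ q → ∣ (λ r c → A r c + t * δ r c) ∣ᴹ ≡ t * (t * q)) →
  ∃ λ u → NonZeroRow u × (∀ r → A r · u ≡ 0ℤ) × w · u ≡ 0ℤ
second-kernel-vector {n} A w (k , wk≢0) wA≡0 double = deflate (kernel (A [ k ≔ w ]) det≡0)
  where
  open ≡-Reasoning
  N : ℤ → Matrix n
  N t r c = A r c + t * δ r c
  wN : ∀ t c → sum (λ r → w r * N t r c) ≡ t * w c
  wN t c = begin
    sum (λ r → w r * N t r c) ≡⟨ sum-linear t (λ r → e t (w r) (A r c) (δ r c)) ⟩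
    t * sum (λ r → w r * δ r c) + sum (λ r → w r * A r c) ≡⟨ cong₂ (λ p q → t * p + q) (sum-δ w c) (wA≡0 c) ⟩
    t * w c + 0ℤ ≡⟨ +-identityʳ (t * w c) ⟩
    t * w c ∎
    where
    e : ∀ t w a d → w * (a + t * d) ≡ t * (w * d) + w * a
    e = solve-∀
  w·N-det : ∀ t → t * ∣ N t [ k ≔ w ] ∣ᴹ ≡ w k * ∣ N t ∣ᴹ
  w·N-det t = begin
    t * ∣ N t [ k ≔ w ] ∣ᴹ
      -- `det-linear` takes two summands; a zero row is supplied as the second, and its determinant
      -- enters as `-1ℤ * y + y`.
      ≡⟨ e t ∣ N t [ k ≔ w ] ∣ᴹ ∣ N t [ k ≔ const 0ℤ ] ∣ᴹ ⟩
    t * ∣ N t [ k ≔ w ] ∣ᴹ + (-1ℤ * ∣ N t [ k ≔ const 0ℤ ] ∣ᴹ + ∣ N t [ k ≔ const 0ℤ ] ∣ᴹ)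
      ≡⟨ cong (λ s → t * ∣ N t [ k ≔ w ] ∣ᴹ + s) (sym (det-linear (N t) k -1ℤ (const 0ℤ) (const 0ℤ))) ⟩
    t * ∣ N t [ k ≔ w ] ∣ᴹ + ∣ N t [ k ≔ const 0ℤ ] ∣ᴹ
      ≡⟨ sym (det-linear (N t) k t w (const 0ℤ)) ⟩
    ∣ N t [ k ≔ (λ c → t * w c + 0ℤ) ] ∣ᴹ
      ≡⟨ det-cong (≔-cong k (λ _ _ → refl) (λ c → trans (+-identityʳ (t * w c)) (sym (wN t c)))) ⟩
    ∣ N t [ k ≔ (λ c → sum (λ r → w r * N t r c)) ] ∣ᴹ
      ≡⟨ cramer (N t) k w ⟩
    w k * ∣ N t ∣ᴹ ∎
    where
    e : ∀ t x y → t * x ≡ t * x + (-1ℤ * y + y)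
    e = solve-∀
  N≡A : ∀ t r c → (N t [ k ≔ w ]) r c ≡ (A [ k ≔ w ]) r c mod t
  N≡A t r c with r Fin.≟ k
  ... | yes refl = by 0ℤ (trans (trans (≔-updates (N t) k w c) (sym (≔-updates A k w c))) (e t ((A [ k ≔ w ]) k c)))
    where
    e : ∀ t x → x ≡ x + t * 0ℤ
    e = solve-∀
  ... | no r≢k   = by (δ r c) (trans (≔-minimal (N t) w c r≢k) (cong (_+ t * δ r c) (sym (≔-minimal A w c r≢k))))
  -- For nonzero `t` this determinant is congruent modulo `t` to that of `N t [ k ≔ w ]`, which
  -- equals `t * (w k * q)`. Divisibility by every such `t` forces zero.
  det≡0 : ∣ A [ k ≔ w ] ∣ᴹ ≡ 0ℤ
  det≡0 = ≡0-of-divisible ∣ A [ k ≔ w ] ∣ᴹ divisible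
    where
    divisible : ∀ t → t ≢ 0ℤ → ∃ λ s → ∣ A [ k ≔ w ] ∣ᴹ ≡ t * s
    divisible t t≢0 with double t | det-mod (N≡A t)
    ... | q , N≡ | by s mod = w k * q - s , (begin
      ∣ A [ k ≔ w ] ∣ᴹ
        ≡⟨ e₁ ∣ A [ k ≔ w ] ∣ᴹ (t * s) ⟩
      (∣ A [ k ≔ w ] ∣ᴹ + t * s) - t * s
        ≡⟨ cong (_- t * s) (trans (sym mod) (*-cancelˡ-≡ t ∣ N t [ k ≔ w ] ∣ᴹ (t * (w k * q)) {{≢-nonZero t≢0}} (begin
             t * ∣ N t [ k ≔ w ] ∣ᴹ ≡⟨ w·N-det t ⟩
             w k * ∣ N t ∣ᴹ ≡⟨ cong (w k *_) N≡ ⟩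
             w k * (t * (t * q)) ≡⟨ e₂ (w k) t q ⟩
             t * (t * (w k * q)) ∎))) ⟩
      t * (w k * q) - t * s
        ≡⟨ e₃ t (w k * q) s ⟩
      t * (w k * q - s) ∎)
      where
      e₁ : ∀ x y → x ≡ (x + y) - y
      e₁ = solve-∀
      e₂ : ∀ w t q → w * (t * (t * q)) ≡ t * (t * (w * q))
      e₂ = solve-∀
      e₃ : ∀ t x s → t * x - t * s ≡ t * (x - s)
      e₃ = solve-∀
  deflate : Kernel (A [ k ≔ w ]) → ∃ λ u → NonZeroRow u × (∀ r → A r · u ≡ 0ℤ) × w · u ≡ 0ℤ
  deflate (u , u≢0 , Bu≡0) = u , u≢0 , Au≡0 ,
    trans (sum-cong-≗ (λ c → cong (_* u c) (sym (≔-updates A k w c)))) (Bu≡0 k)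
    where
    others : ∀ r → r ≢ k → A r · u ≡ 0ℤ
    others r r≢k = trans (sum-cong-≗ (λ c → cong (_* u c) (sym (≔-minimal A w c r≢k)))) (Bu≡0 r)
    -- Row `k` of `A` was overwritten, but the relation `w` among the rows of `A` recovers it from
    -- the others, as `w k` is nonzero.
    Ak≡0 : A k · u ≡ 0ℤ
    Ak≡0 = *-cancel-≢0 wk≢0 (begin
      w k * (A k · u)
        ≡⟨ sym (sum-single k (λ r → w r * (A r · u)) (λ r r≢k → trans (cong (w r *_) (others r r≢k)) (*-zeroʳ (w r)))) ⟩
      sum (λ r → w r * (A r · u))
        ≡⟨ sum-cong-≗ (λ r → *-distribˡ-sum (w r) (λ c → A r c * u c)) ⟩
      sum (λ r → sum (λ c → w r * (A r c * u c)))
        ≡⟨ ∑-comm (λ r c → w r * (A r c * u c)) ⟩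
      sum (λ c → sum (λ r → w r * (A r c * u c)))
        ≡⟨ sum-zero (λ c → trans (sum-cong-≗ (λ r → e (w r) (A r c) (u c)))
             (trans (sym (*-distribˡ-sum (u c) (λ r → w r * A r c))) (trans (cong (u c *_) (wA≡0 c)) (*-zeroʳ (u c))))) ⟩
      0ℤ ∎)
      where
      e : ∀ w a u → w * (a * u) ≡ u * (w * a)
      e = solve-∀
    Au≡0 : ∀ r → A r · u ≡ 0ℤ
    Au≡0 r with r Fin.≟ k
    ... | yes refl = Ak≡0
    ... | no r≢k   = others r r≢k

-- Eigenvectors of the Laplacian

weight : Bool → ℤ
weight b = if b then 1ℤ else 0ℤ

-- The values of e on the diagonal are irrelevant.
record Eigen {n} (e : Fin n → Fin n → Bool) (μ : ℤ) (z : Row n) : Set where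
  constructor eigen
  field equation : ∀ u → sum (λ v → weight (e u v) * (z u - z v)) ≡ μ * z u
open Eigen

Symmetric : ∀ {n} → (Fin n → Fin n → Bool) → Set
Symmetric e = ∀ u v → e u v ≡ e v u

0≤square : ∀ x → 0ℤ ≤ x * x
0≤square +0       = ≤-refl
0≤square +[1+ _ ] = +≤+ ℕ.z≤n
0≤square -[1+ _ ] = +≤+ ℕ.z≤n

square≡0 : ∀ {x} → x * x ≡ 0ℤ → x ≡ 0ℤ
square≡0 {x} xx≡0 with i*j≡0⇒i≡0∨j≡0 x xx≡0
... | inj₁ x≡0 = x≡0
... | inj₂ x≡0 = x≡0

module _ {n} {e : Fin n → Fin n → Bool} (e-sym : Symmetric e) where

  -- Summing the eigenvalue equation over all vertices, the two orientations of each edge cancel,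
  -- which leaves `μ * sum z ≡ 0ℤ`.
  eigen-sum : ∀ {μ z} → μ ≢ 0ℤ → Eigen e μ z → sum z ≡ 0ℤ
  eigen-sum {μ} {z} μ≢0 eig = *-cancel-≢0 μ≢0 (begin
    μ * sum z               ≡⟨ *-distribˡ-sum μ z ⟩
    sum (λ u → μ * z u)     ≡⟨ sum-cong-≗ (λ u → sym (equation eig u)) ⟩
    sum (λ u → sum (λ v → weight (e u v) * (z u - z v)))
      ≡⟨ sum-antisym (λ u v → weight (e u v) * (z u - z v))
           (λ u v → trans (cong (λ b → weight b * (z u - z v)) (e-sym u v)) (anti (weight (e v u)) (z u) (z v))) ⟩
    0ℤ ∎)
    where
    open ≡-Reasoning
    anti : ∀ w x y → w * (x - y) ≡ - (w * (y - x))
    anti = solve-∀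

  -- The Dirichlet energy argument: pairing the equation with `x` shows that the squared differences
  -- along edges sum to zero, so each of them vanishes.
  harmonic-edge : ∀ {x} → Eigen e 0ℤ x → ∀ u v → e u v ≡ true → x u ≡ x v
  harmonic-edge {x} eig u v uv = i-j≡0⇒i≡j (x u) (x v) (square≡0
    (trans (sym (*-identityˡ ((x u - x v) * (x u - x v))))
      (trans (cong (λ b → weight b * ((x u - x v) * (x u - x v))) (sym uv)) (sq≡0 u v))))
    where
    open ≡-Reasoning
    g sq : Fin n → Fin n → ℤ
    g u v = x u * (weight (e u v) * (x u - x v))
    sq u v = weight (e u v) * ((x u - x v) * (x u - x v))
    0≤sq : ∀ u v → 0ℤ ≤ sq u v
    0≤sq u v with e u v
    ... | true  = subst (0ℤ ≤_) (sym (*-identityˡ ((x u - x v) * (x u - x v)))) (0≤square (x u - x v))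
    ... | false = ≤-refl
    sum-g : sum (λ u → sum (g u)) ≡ 0ℤ
    sum-g = sum-zero (λ u → trans (sym (*-distribˡ-sum (x u) (λ v → weight (e u v) * (x u - x v))))
      (trans (cong (x u *_) (equation eig u)) (*-zeroʳ (x u))))
    split : ∀ w a b → w * ((a - b) * (a - b)) ≡ a * (w * (a - b)) + b * (w * (b - a))
    split = solve-∀
    sum-sq : sum (λ u → sum (sq u)) ≡ 0ℤ
    sum-sq = begin
      sum (λ u → sum (sq u))
        ≡⟨ sum-cong-≗ (λ u → trans
             (sum-cong-≗ (λ v → trans (split (weight (e u v)) (x u) (x v))
               (cong (λ b → g u v + x v * (weight b * (x v - x u))) (e-sym u v))))
             (∑-distrib-+ (g u) (λ v → g v u))) ⟩
      sum (λ u → sum (g u) + sum (λ v → g v u))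
        ≡⟨ ∑-distrib-+ (λ u → sum (g u)) (λ u → sum (λ v → g v u)) ⟩
      sum (λ u → sum (g u)) + sum (λ u → sum (λ v → g v u))
        ≡⟨ cong₂ _+_ sum-g (trans (∑-comm (λ u v → g v u)) sum-g) ⟩
      0ℤ ∎
    sq≡0 : ∀ u v → sq u v ≡ 0ℤ
    sq≡0 u = sum-nonNeg≤0 (0≤sq u) (≤-reflexive
      (sum-nonNeg≤0 (λ u → sum-nonNeg (0≤sq u)) (≤-reflexive sum-sq) u))

-- Complements and isolated vertices

complement : ∀ {n} → (Fin n → Fin n → Bool) → Fin n → Fin n → Bool
complement e u v = not (e u v)

-- The weights of a pair in a graph and in its complement add up to one, and the Laplacian of the
-- complete graph multiplies zero-sum vectors by `n`.
eigen-complement : ∀ {n} {e : Fin n → Fin n → Bool} {μ z} → sum z ≡ 0ℤ → Eigen e μ z →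
                   Eigen (complement e) (+ n - μ) z
eigen-complement {n} {e} {μ} {z} sum≡0 eig = eigen λ u → begin
  sum (λ v → weight (not (e u v)) * (z u - z v))
    ≡⟨ sum-cong-≗ (λ v → complementary (e u v) (z u - z v)) ⟩
  sum (λ v → (z u - z v) - weight (e u v) * (z u - z v))
    ≡⟨ sum-minus (λ v → z u - z v) (λ v → weight (e u v) * (z u - z v)) ⟩
  sum (λ v → z u - z v) - sum (λ v → weight (e u v) * (z u - z v))
    ≡⟨ cong₂ _-_ (trans (sum-minus (λ _ → z u) z) (cong₂ _-_ (sum-const n (z u)) sum≡0)) (equation eig u) ⟩
  (+ n * z u - 0ℤ) - μ * z u
    ≡⟨ collect (+ n) μ (z u) ⟩
  (+ n - μ) * z u ∎
  where
  open ≡-Reasoning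
  collect : ∀ n μ z → (n * z - 0ℤ) - μ * z ≡ (n - μ) * z
  collect = solve-∀
  e₁ : ∀ d → 0ℤ * d ≡ d - 1ℤ * d
  e₁ = solve-∀
  e₂ : ∀ d → 1ℤ * d ≡ d - 0ℤ * d
  e₂ = solve-∀
  complementary : ∀ b d → weight (not b) * d ≡ d - weight b * d
  complementary true  = e₁
  complementary false = e₂

argmax : ∀ {n} (y : Row (suc n)) → ∃ λ u → ∀ v → y v ≤ y u
argmax {zero}  y = zero , λ { zero → ≤-refl }
argmax {suc n} y with argmax (y ∘ suc)
... | u , max with ≤-total (y zero) (y (suc u))
...   | inj₁ y₀≤ = suc u , λ { zero → y₀≤ ; (suc v) → max v }
...   | inj₂ ≤y₀ = zero , λ { zero → ≤-refl ; (suc v) → ≤-trans (max v) ≤y₀ }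

-- Were the maximum not positive, all entries would be nonpositive with zero sum, hence zero.
max-positive : ∀ {n} {y : Row n} {u} → NonZeroRow y → sum y ≡ 0ℤ → (∀ v → y v ≤ y u) → 0ℤ < y u
max-positive {y = y} {u} (v , yv≢0) sum≡0 max = ≰⇒> λ yu≤0 →
  yv≢0 (trans (sym (neg-involutive (y v))) (cong -_
    (sum-nonNeg≤0 {f = -_ ∘ y} (λ w → neg-mono-≤ (≤-trans (max w) yu≤0))
      (≤-reflexive (trans (sum-neg {f = -_ ∘ y} {g = y} (λ _ → refl)) (cong -_ sum≡0))) v)))

-- The vertices where x takes its value at a maximum u of y span a union of components;
-- there y sums to zero, so the equation at u bounds the eigenvalue m by their number.
-- Hence x takes another value at one vertex only.
isolated : ∀ {m} {e : Fin (suc m) → Fin (suc m) → Bool} → Symmetric e → + m ≢ 0ℤ →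
  ∀ {x y} → NonZeroRow x → sum x ≡ 0ℤ → Eigen e 0ℤ x → NonZeroRow y → Eigen e (+ m) y →
  ∃ λ a → ∃ λ c → (∀ v → v ≢ a → x v ≡ c) × (∀ v → v ≢ a → e a v ≡ false)
isolated {m} {e} e-sym m≢0 {x} {y} (b , xb≢0) x-sum x-eig y≢0 y-eig = result (argmax y)
  where
  y-sum : sum y ≡ 0ℤ
  y-sum = eigen-sum e-sym m≢0 y-eig
  edge : ∀ u v → e u v ≡ true → x u ≡ x v
  edge = harmonic-edge e-sym x-eig

  module _ (u : Fin (suc m)) (max : ∀ v → y v ≤ y u) where
    P : Fin (suc m) → ℤ
    P v = weight (does (x v ≟ x u))
    F : Fin (suc m) → Fin (suc m) → ℤ
    F v w = P v * (weight (e v w) * (y v - y w))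
    -- An edge joins vertices with equal `x`, so the indicator `P` of the level set takes the same
    -- value at both ends.
    F-antisym : ∀ v w → F v w ≡ - F w v
    F-antisym v w = trans (signed (e v w) refl) (cong (λ b → - (P w * (weight b * (y w - y v)))) (e-sym v w))
      where
      anti₁ : ∀ p y z → p * (1ℤ * (y - z)) ≡ - (p * (1ℤ * (z - y)))
      anti₁ = solve-∀
      anti₀ : ∀ p q y z → p * (0ℤ * (y - z)) ≡ - (q * (0ℤ * (z - y)))
      anti₀ = solve-∀
      signed : ∀ b → e v w ≡ b → P v * (weight b * (y v - y w)) ≡ - (P w * (weight b * (y w - y v)))
      signed true  vw = trans (cong (λ t → weight (does (t ≟ x u)) * (1ℤ * (y v - y w))) (edge v w vw)) (anti₁ (P w) (y v) (y w))
      signed false _  = anti₀ (P v) (P w) (y v) (y w)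
    sum-Py : sum (λ v → P v * y v) ≡ 0ℤ
    sum-Py = *-cancel-≢0 m≢0 (begin
      + m * sum (λ v → P v * y v)       ≡⟨ *-distribˡ-sum (+ m) (λ v → P v * y v) ⟩
      sum (λ v → + m * (P v * y v))     ≡⟨ sum-cong-≗ (λ v → trans (swap (+ m) (P v) (y v))
                                             (trans (cong (P v *_) (sym (equation y-eig v)))
                                               (*-distribˡ-sum (P v) (λ w → weight (e v w) * (y v - y w))))) ⟩
      sum (λ v → sum (F v))             ≡⟨ sum-antisym F F-antisym ⟩
      0ℤ ∎)
      where
      open ≡-Reasoning
      swap : ∀ a b c → a * (b * c) ≡ b * (a * c)
      swap = solve-∀
    0≤P* : ∀ v → 0ℤ ≤ P v * (y u - y v)
    0≤P* v with does (x v ≟ x u)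
    ... | true  = subst (0ℤ ≤_) (sym (*-identityˡ (y u - y v))) (i≤j⇒0≤j-i (max v))
    ... | false = ≤-refl
    -- All neighbours of `u` lie in its level set, and `y u - y v` is never negative.
    weight≤P : ∀ v → weight (e u v) * (y u - y v) ≤ P v * (y u - y v)
    weight≤P v with e u v in uv
    ... | false = 0≤P* v
    ... | true with x v ≟ x u
    ...   | yes _    = ≤-refl
    ...   | no xv≢xu = contradiction (sym (edge u v uv)) xv≢xu
    m≤P : + m ≤ sum P
    m≤P = *-cancelʳ-≤-pos (+ m) (sum P) (y u) {{positive (max-positive {y = y} {u} y≢0 y-sum max)}} (begin
      + m * y u                                       ≡⟨ sym (equation y-eig u) ⟩
      sum (λ v → weight (e u v) * (y u - y v))        ≤⟨ sum-mono weight≤P ⟩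
      sum (λ v → P v * (y u - y v))
        ≡⟨ sum-linear (y u) (λ v → distrib (P v) (y u) (y v)) ⟩
      y u * sum P + sum (λ v → - (P v * y v))
        ≡⟨ cong (λ t → y u * sum P + t) (trans (sum-neg {f = λ v → - (P v * y v)} {g = λ v → P v * y v} (λ _ → refl)) (cong -_ sum-Py)) ⟩
      y u * sum P + - 0ℤ                              ≡⟨ +-identityʳ (y u * sum P) ⟩
      y u * sum P                                     ≡⟨ *-comm (y u) (sum P) ⟩
      sum P * y u ∎)
      where
      open ≤-Reasoning
      distrib : ∀ p y z → p * (y - z) ≡ y * p + - (p * z)
      distrib = solve-∀
    Q : Fin (suc m) → ℤ
    Q v = 1ℤ - P v
    0≤Q : ∀ v → 0ℤ ≤ Q v
    0≤Q v with does (x v ≟ x u)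
    ... | true  = ≤-refl
    ... | false = +≤+ ℕ.z≤n
    Q≤1 : sum Q ≤ 1ℤ
    Q≤1 = begin
      sum Q                                ≡⟨ sum-minus (λ _ → 1ℤ) P ⟩
      sum {suc m} (λ _ → 1ℤ) - sum P       ≡⟨ cong (_- sum P) (sum-const (suc m) 1ℤ) ⟩
      (1ℤ + + m) * 1ℤ - sum P              ≤⟨ +-monoʳ-≤ ((1ℤ + + m) * 1ℤ) (neg-mono-≤ m≤P) ⟩
      (1ℤ + + m) * 1ℤ - + m                ≡⟨ cancel (+ m) ⟩
      1ℤ ∎
      where
      open ≤-Reasoning
      cancel : ∀ m → (1ℤ + m) * 1ℤ - m ≡ 1ℤ
      cancel = solve-∀
    Q≡1 : ∀ {v} → x v ≢ x u → Q v ≡ 1ℤ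
    Q≡1 {v} xv≢xu with x v ≟ x u
    ... | yes xv≡xu = contradiction xv≡xu xv≢xu
    ... | no _      = refl
    Q≡0 : ∀ {v} → Q v ≡ 0ℤ → x v ≡ x u
    Q≡0 {v} Qv≡0 with x v ≟ x u
    ... | yes xv≡xu = xv≡xu
    Q≡0 {v} () | no _
    others : ∀ a → x a ≢ x u → ∀ v → v ≢ a → x v ≡ x u
    others a xa≢xu v v≢a = Q≡0 (trans (cong Q (sym (punchIn-punchOut (v≢a ∘ sym))))
      (sum-nonNeg≤0 (0≤Q ∘ punchIn a) rest≤0 (punchOut (v≢a ∘ sym))))
      where
      -- `Q` indicates the vertices outside the level set; `a` alone already uses up the bound 1 on
      -- their number.
      rest≤0 : sum (Q ∘ punchIn a) ≤ 0ℤ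
      rest≤0 = subst (_≤ 0ℤ) (cancel (sum (Q ∘ punchIn a))) (+-monoʳ-≤ -1ℤ
        (subst (_≤ 1ℤ) (trans (sum-remove {i = a} Q) (cong (_+ sum (Q ∘ punchIn a)) (Q≡1 xa≢xu))) Q≤1))
        where
        cancel : ∀ x → -1ℤ + (1ℤ + x) ≡ x
        cancel = solve-∀

  result : (∃ λ u → ∀ v → y v ≤ y u) →
    ∃ λ a → ∃ λ c → (∀ v → v ≢ a → x v ≡ c) × (∀ v → v ≢ a → e a v ≡ false)
  result (u , max) with any? (λ a → ¬? (x a ≟ x u))
  ... | yes (a , xa≢xu) = a , x u , others u max a xa≢xu , nonadjacent
    where
    nonadjacent : ∀ v → v ≢ a → e a v ≡ false
    nonadjacent v v≢a with e a v in av
    ... | true  = contradiction (trans (edge a v av) (others u max a xa≢xu v v≢a)) xa≢xu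
    ... | false = refl
  -- Otherwise `x` is constant with zero sum, hence zero.
  ... | no none = contradiction (trans (constant b) xu≡0) xb≢0
    where
    constant : ∀ v → x v ≡ x u
    constant v = decidable-stable (x v ≟ x u) (λ ≢ → none (v , ≢))
    xu≡0 : x u ≡ 0ℤ
    xu≡0 = *-cancel-≢0 {+ suc m} (λ ()) (trans (sym (sum-const (suc m) (x u)))
      (trans (sum-cong-≗ (λ v → sym (constant v))) x-sum))

-- The zero sum reads `x a + + m * c ≡ 0ℤ`, so if one of the two values `x a` and `c` vanishes, both
-- do.
constant-off-vertex⇒nowhere-0 : ∀ {m} {x : Row (suc m)} {a c} → + m ≢ 0ℤ → NonZeroRow x → sum x ≡ 0ℤ →
  (∀ v → v ≢ a → x v ≡ c) → ∀ v → x v ≢ 0ℤ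
constant-off-vertex⇒nowhere-0 {m} {x} {a} {c} m≢0 (b , xb≢0) x-sum x≡c v xv≡0 = xb≢0 (zero-at b)
  where
  total : x a + + m * c ≡ 0ℤ
  total = trans (cong (λ t → x a + t) (trans (sym (sum-const m c))
    (sum-cong-≗ (λ i → sym (x≡c (punchIn a i) (punchInᵢ≢i a i))))))
    (trans (sym (sum-remove {i = a} x)) x-sum)
  c≡0 : c ≡ 0ℤ
  c≡0 with v Fin.≟ a
  ... | yes refl = *-cancel-≢0 m≢0 (trans (sym (+-identityˡ (+ m * c))) (trans (cong (_+ + m * c) (sym xv≡0)) total))
  ... | no v≢a   = trans (sym (x≡c v v≢a)) xv≡0
  xa≡0 : x a ≡ 0ℤ
  xa≡0 = trans (sym (+-identityʳ (x a))) (trans (cong (λ t → x a + t) (sym (trans (cong (+ m *_) c≡0) (*-zeroʳ (+ m))))) total)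
  zero-at : ∀ w → x w ≡ 0ℤ
  zero-at w with w Fin.≟ a
  ... | yes refl = xa≡0
  ... | no w≢a   = trans (x≡c w w≢a) c≡0

-- Iterated deletion and complementation

-- The condition `sum z ≡ 0ℤ` excludes nonzero constant vectors, so for symmetric `e` having
-- `Eigenvalue e 0ℤ` expresses disconnectedness.
Eigenvalue : ∀ {n} → (Fin n → Fin n → Bool) → ℤ → Set
Eigenvalue e μ = ∃ λ z → NonZeroRow z × sum z ≡ 0ℤ × Eigen e μ z

-- The eigenspace is at most a line.
Rigid : ∀ {n} → (Fin n → Fin n → Bool) → ℤ → Set
Rigid e μ = ∃ λ v → ∀ z → sum z ≡ 0ℤ → Eigen e μ z → z v ≡ 0ℤ → ∀ u → z u ≡ 0ℤ

co-delete : ∀ {m} → (Fin (suc m) → Fin (suc m) → Bool) → Fin (suc m) → Fin m → Fin m → Bool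
co-delete e a u v = not (e (punchIn a u) (punchIn a v))

module _ {m} {e : Fin (suc m) → Fin (suc m) → Bool} (e-sym : Symmetric e)
         {a} (a-isolated : ∀ v → v ≢ a → e a v ≡ false) where

  co-delete-sym : Symmetric (co-delete e a)
  co-delete-sym u v = cong not (e-sym (punchIn a u) (punchIn a v))

  private
    module Restrict {μ z} (μ≢0 : μ ≢ 0ℤ) (z-eig : Eigen e μ z) where

      za≡0 : z a ≡ 0ℤ
      za≡0 = *-cancel-≢0 μ≢0 (trans (sym (equation z-eig a)) (sum-zero term))
        where
        term : ∀ v → weight (e a v) * (z a - z v) ≡ 0ℤ
        term v with v Fin.≟ a
        ... | yes refl = trans (cong (weight (e a a) *_) (+-inverseʳ (z a))) (*-zeroʳ (weight (e a a)))
        ... | no v≢a   = cong (λ b → weight b * (z a - z v)) (a-isolated v v≢a)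

      sum≡0 : sum (z ∘ punchIn a) ≡ 0ℤ
      sum≡0 = trans (sym (+-identityˡ (sum (z ∘ punchIn a)))) (trans (cong (_+ sum (z ∘ punchIn a)) (sym za≡0))
        (trans (sym (sum-remove {i = a} z)) (eigen-sum e-sym μ≢0 z-eig)))

      eigen-co-delete : Eigen (co-delete e a) (+ m - μ) (z ∘ punchIn a)
      eigen-co-delete = eigen-complement {e = λ u v → e (punchIn a u) (punchIn a v)} {μ} sum≡0 (eigen λ u → begin
        sum (λ v → weight (e (punchIn a u) (punchIn a v)) * (z (punchIn a u) - z (punchIn a v)))
          -- The added `0ℤ` becomes the term of the deleted vertex `a`, to which no other vertex is
          -- adjacent.
          ≡⟨ sym (+-identityˡ _) ⟩
        0ℤ + sum (λ v → weight (e (punchIn a u) (punchIn a v)) * (z (punchIn a u) - z (punchIn a v)))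
          ≡⟨ cong (_+ sum (λ v → weight (e (punchIn a u) (punchIn a v)) * (z (punchIn a u) - z (punchIn a v))))
               (cong (λ b → weight b * (z (punchIn a u) - z a))
                 (sym (trans (e-sym (punchIn a u) a) (a-isolated (punchIn a u) (punchInᵢ≢i a u))))) ⟩
        weight (e (punchIn a u) a) * (z (punchIn a u) - z a) +
          sum (λ v → weight (e (punchIn a u) (punchIn a v)) * (z (punchIn a u) - z (punchIn a v)))
          ≡⟨ sym (sum-remove {i = a} (λ v → weight (e (punchIn a u) v) * (z (punchIn a u) - z v))) ⟩
        sum (λ v → weight (e (punchIn a u) v) * (z (punchIn a u) - z v))
          ≡⟨ equation z-eig (punchIn a u) ⟩
        μ * z (punchIn a u) ∎)
        where open ≡-Reasoning

      extend : ∀ {v} → v ≢ a → ∃ λ i → z (punchIn a i) ≡ z v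
      extend v≢a = punchOut (v≢a ∘ sym) , cong z (punchIn-punchOut (v≢a ∘ sym))

  -- The eigenvector vanishes at `a`, so a nonzero entry survives the restriction. The new
  -- eigenvalue is given through an equation to let callers supply it in simplified form.
  co-delete-eigenvalue : ∀ {μ ν} → μ ≢ 0ℤ → + m - μ ≡ ν → Eigenvalue e μ → Eigenvalue (co-delete e a) ν
  co-delete-eigenvalue {μ} μ≢0 refl (z , (v , zv≢0) , z-sum , z-eig) =
    z ∘ punchIn a , nonZeroRow (extend (λ v≡a → zv≢0 (trans (cong z v≡a) za≡0))) , sum≡0 , eigen-co-delete
    where
    open Restrict {μ} {z} μ≢0 z-eig
    nonZeroRow : (∃ λ i → z (punchIn a i) ≡ z v) → NonZeroRow (z ∘ punchIn a)
    nonZeroRow (i , eq) = i , λ ≡0 → zv≢0 (trans (sym eq) ≡0)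

  -- Rigidity travels in the opposite direction: an eigenvector on `e` vanishes at `a` and restricts
  -- to the smaller graph, whose witness vertex is carried back by `punchIn a`.
  co-delete-rigid : ∀ {μ ν} → μ ≢ 0ℤ → + m - μ ≡ ν → Rigid (co-delete e a) ν → Rigid e μ
  co-delete-rigid {μ} μ≢0 refl (w , rigid) = punchIn a w , λ z z-sum z-eig zw≡0 u →
    let open Restrict {μ} {z} μ≢0 z-eig in
    vanish z za≡0 extend (rigid (z ∘ punchIn a) sum≡0 eigen-co-delete zw≡0) u
    where
    vanish : ∀ z → z a ≡ 0ℤ → (∀ {v} → v ≢ a → ∃ λ i → z (punchIn a i) ≡ z v) →
             (∀ i → z (punchIn a i) ≡ 0ℤ) → ∀ u → z u ≡ 0ℤ
    vanish z za≡0 extend rest u with u Fin.≟ a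
    ... | yes refl = za≡0
    ... | no u≢a with extend u≢a
    ...   | i , eq = trans (sym eq) (rest i)

-- By `isolated`, a nonzero harmonic vector with zero sum is constant off one vertex and therefore
-- vanishes nowhere; any vertex can serve as witness.
rigid₁ : ∀ {k} {e : Fin (suc k) → Fin (suc k) → Bool} → + k ≢ 0ℤ → Symmetric e →
         Eigenvalue e (+ k) → Rigid e 0ℤ
rigid₁ k≢0 e-sym (y , y≢0 , _ , y-eig) = zero , λ z z-sum z-eig z₀≡0 u →
  decidable-stable (z u ≟ 0ℤ) λ zu≢0 → nowhere z z-sum z-eig (u , zu≢0) z₀≡0
  where
  nowhere : ∀ z → sum z ≡ 0ℤ → Eigen _ 0ℤ z → NonZeroRow z → z zero ≢ 0ℤ
  nowhere z z-sum z-eig z≢0 with isolated e-sym k≢0 z≢0 z-sum z-eig y≢0 y-eig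
  ... | a , c , z≡c , _ = constant-off-vertex⇒nowhere-0 k≢0 z≢0 z-sum z≡c zero

-- The eigenvalues `0` and `1 + k` produce an isolated vertex. On the other `1 + k` vertices,
-- complementing turns `1` into the large eigenvalue `k` needed by `rigid₁`, and the target `1 + k`
-- into `0`.
rigid₂ : ∀ {k} {e : Fin (2 ℕ.+ k) → Fin (2 ℕ.+ k) → Bool} → + k ≢ 0ℤ → Symmetric e →
         Eigenvalue e 0ℤ → Eigenvalue e (+ (1 ℕ.+ k)) → Eigenvalue e 1ℤ → Rigid e (+ (1 ℕ.+ k))
rigid₂ {k} k≢0 e-sym (x , x≢0 , x-sum , x-eig) (y , y≢0 , _ , y-eig) ev₁
  with isolated e-sym (λ ()) x≢0 x-sum x-eig y≢0 y-eig
... | a , _ , _ , iso = co-delete-rigid e-sym iso (λ ()) (+-inverseʳ (+ (1 ℕ.+ k)))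
  (rigid₁ k≢0 (co-delete-sym e-sym iso) (co-delete-eigenvalue e-sym iso (λ ()) refl ev₁))

-- With `2 + k` vertices left, complementing turns `2 + k`, `1`, `1 + k` into the `0`, `1 + k`, `1`
-- of `rigid₂`, and the target `1` into `1 + k`.
rigid₃ : ∀ {k} {e : Fin (3 ℕ.+ k) → Fin (3 ℕ.+ k) → Bool} → + k ≢ 0ℤ → Symmetric e →
         Eigenvalue e 0ℤ → Eigenvalue e (+ (2 ℕ.+ k)) → Eigenvalue e 1ℤ → Eigenvalue e (+ (1 ℕ.+ k)) →
         Rigid e 1ℤ
rigid₃ {k} k≢0 e-sym (x , x≢0 , x-sum , x-eig) ev-max@(y , y≢0 , _ , y-eig) ev₁ ev₂
  with isolated e-sym (λ ()) x≢0 x-sum x-eig y≢0 y-eig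
... | a , _ , _ , iso = co-delete-rigid e-sym iso (λ ()) refl
  (rigid₂ k≢0 (co-delete-sym e-sym iso)
    (co-delete-eigenvalue e-sym iso (λ ()) (+-inverseʳ (+ (2 ℕ.+ k))) ev-max)
    (co-delete-eigenvalue e-sym iso (λ ()) refl ev₁)
    (co-delete-eigenvalue e-sym iso (λ ()) (difference (+ k)) ev₂))
  where
  difference : ∀ k → (+ 2 + k) - (1ℤ + k) ≡ 1ℤ
  difference = solve-∀

-- With `3 + k` vertices left, complementing turns `3 + k`, `1`, `2 + k`, `2` into the `0`, `2 + k`,
-- `1`, `1 + k` of `rigid₃`, and the target `2 + k` into `1`.
rigid₄ : ∀ {k} {e : Fin (4 ℕ.+ k) → Fin (4 ℕ.+ k) → Bool} → + k ≢ 0ℤ → Symmetric e →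
         Eigenvalue e 0ℤ → Eigenvalue e (+ (3 ℕ.+ k)) → Eigenvalue e 1ℤ → Eigenvalue e (+ (2 ℕ.+ k)) →
         Eigenvalue e (+ 2) → Rigid e (+ (2 ℕ.+ k))
rigid₄ {k} k≢0 e-sym (x , x≢0 , x-sum , x-eig) ev-max@(y , y≢0 , _ , y-eig) ev₁ ev₂ ev₃
  with isolated e-sym (λ ()) x≢0 x-sum x-eig y≢0 y-eig
... | a , _ , _ , iso = co-delete-rigid e-sym iso (λ ()) (difference (+ k))
  (rigid₃ k≢0 (co-delete-sym e-sym iso)
    (co-delete-eigenvalue e-sym iso (λ ()) (+-inverseʳ (+ (3 ℕ.+ k))) ev-max)
    (co-delete-eigenvalue e-sym iso (λ ()) refl ev₁)
    (co-delete-eigenvalue e-sym iso (λ ()) (difference (+ k)) ev₂)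
    (co-delete-eigenvalue e-sym iso (λ ()) refl ev₃))
  where
  difference : ∀ k → (+ 3 + k) - (+ 2 + k) ≡ 1ℤ
  difference = solve-∀

-- The combination `X` of `z` and `z′` that vanishes at the witness `v` vanishes everywhere. Pairing
-- it with `z′` gives `z v * (z′ · z′) ≡ 0ℤ` when `z` and `z′` are orthogonal, so `z v` and then all
-- of `z` is zero.
rigid⇒not-orthogonal : ∀ {n} {e : Fin n → Fin n → Bool} {μ} → Rigid e μ →
  ∀ {z z′} → NonZeroRow z → sum z ≡ 0ℤ → Eigen e μ z → NonZeroRow z′ → sum z′ ≡ 0ℤ → Eigen e μ z′ →
  z · z′ ≢ 0ℤ
rigid⇒not-orthogonal {n} {e} {μ} (v , rigid) {z} {z′} (b , zb≢0) z-sum z-eig (b′ , z′b′≢0) z′-sum z′-eig z·z′≡0 =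
  zb≢0 (rigid z z-sum z-eig zv≡0 b)
  where
  open ≡-Reasoning
  X : Row n
  X u = z′ v * z u + - z v * z′ u
  X-sum : sum X ≡ 0ℤ
  X-sum = trans (sum-linear (z′ v) {z} {λ u → - z v * z′ u} (λ u → refl)) (trans
    (cong₂ (λ s t → z′ v * s + t) z-sum (trans (sym (*-distribˡ-sum (- z v) z′)) (cong (- z v *_) z′-sum)))
    (e₀ (z′ v) (- z v)))
    where
    e₀ : ∀ a b → a * 0ℤ + b * 0ℤ ≡ 0ℤ
    e₀ = solve-∀
  X-eig : Eigen e μ X
  X-eig = eigen λ u → begin
    sum (λ w → weight (e u w) * (X u - X w))
      ≡⟨ sum-linear (z′ v) (λ w → e₁ (z′ v) (- z v) (weight (e u w)) (z u) (z w) (z′ u) (z′ w)) ⟩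
    z′ v * sum (λ w → weight (e u w) * (z u - z w)) + sum (λ w → - z v * (weight (e u w) * (z′ u - z′ w)))
      ≡⟨ cong₂ (λ s t → z′ v * s + t) (equation z-eig u)
           (trans (sym (*-distribˡ-sum (- z v) (λ w → weight (e u w) * (z′ u - z′ w)))) (cong (- z v *_) (equation z′-eig u))) ⟩
    z′ v * (μ * z u) + - z v * (μ * z′ u)
      ≡⟨ e₂ (z′ v) (- z v) μ (z u) (z′ u) ⟩
    μ * X u ∎
    where
    e₁ : ∀ a b w x y x′ y′ →
         w * ((a * x + b * x′) - (a * y + b * y′)) ≡ a * (w * (x - y)) + b * (w * (x′ - y′))
    e₁ = solve-∀
    e₂ : ∀ a b μ x x′ → a * (μ * x) + b * (μ * x′) ≡ μ * (a * x + b * x′)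
    e₂ = solve-∀
  X≡0 : ∀ u → X u ≡ 0ℤ
  X≡0 = rigid X X-sum X-eig (e₀ (z′ v) (z v))
    where
    e₀ : ∀ a b → a * b + - b * a ≡ 0ℤ
    e₀ = solve-∀
  norm≢0 : z′ · z′ ≢ 0ℤ
  norm≢0 norm≡0 = z′b′≢0 (square≡0 (sum-nonNeg≤0 (λ u → 0≤square (z′ u)) (≤-reflexive norm≡0) b′))
  zv≡0 : z v ≡ 0ℤ
  zv≡0 = *-cancel-≢0 norm≢0 (begin
    (z′ · z′) * z v
      ≡⟨ e₁ (z′ v) (z · z′) (z′ · z′) (z v) ⟩
    z′ v * (z · z′) - (z′ v * (z · z′) + - z v * (z′ · z′))
      ≡⟨ cong₂ (λ s t → z′ v * s - t) z·z′≡0 (trans (sym expand) (sum-zero (λ u → cong (_* z′ u) (X≡0 u)))) ⟩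
    z′ v * 0ℤ - 0ℤ
      ≡⟨ e₂ (z′ v) ⟩
    0ℤ ∎)
    where
    e₁ : ∀ a p q b → q * b ≡ a * p - (a * p + - b * q)
    e₁ = solve-∀
    e₂ : ∀ a → a * 0ℤ - 0ℤ ≡ 0ℤ
    e₂ = solve-∀
    expand : X · z′ ≡ z′ v * (z · z′) + - z v * (z′ · z′)
    expand = trans (·-linearˡ (z′ v) z (λ u → - z v * z′ u) z′)
      (cong (λ t → z′ v * (z · z′) + t) (trans (sum-cong-≗ (λ u → *-assoc (- z v) (z′ u) (z′ u)))
        (sym (*-distribˡ-sum (- z v) (λ u → z′ u * z′ u)))))

-- Evaluation of polynomials

eval : Poly → ℤ → ℤ
eval []      x = 0ℤ
eval (a ∷ p) x = a + x * eval p x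

eval-+ₚ : ∀ p q x → eval (p +ₚ q) x ≡ eval p x + eval q x
eval-+ₚ []      q       x = sym (+-identityˡ (eval q x))
eval-+ₚ (a ∷ p) []      x = sym (+-identityʳ (eval (a ∷ p) x))
eval-+ₚ (a ∷ p) (b ∷ q) x = trans (cong (λ t → (a + b) + x * t) (eval-+ₚ p q x)) (e a b x (eval p x) (eval q x))
  where
  e : ∀ a b x p q → (a + b) + x * (p + q) ≡ (a + x * p) + (b + x * q)
  e = solve-∀

eval-scaleₚ : ∀ c p x → eval (scaleₚ c p) x ≡ c * eval p x
eval-scaleₚ c []      x = sym (*-zeroʳ c)
eval-scaleₚ c (a ∷ p) x = trans (cong (λ t → c * a + x * t) (eval-scaleₚ c p x)) (e c a x (eval p x))
  where
  e : ∀ c a x p → c * a + x * (c * p) ≡ c * (a + x * p)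
  e = solve-∀

eval-*ₚ : ∀ p q x → eval (p *ₚ q) x ≡ eval p x * eval q x
eval-*ₚ []      q x = sym (*-zeroˡ (eval q x))
eval-*ₚ (a ∷ p) q x = trans (eval-+ₚ (scaleₚ a q) (0ℤ ∷ (p *ₚ q)) x)
  (trans (cong₂ (λ s t → s + (0ℤ + x * t)) (eval-scaleₚ a q x) (eval-*ₚ p q x)) (e a x (eval p x) (eval q x)))
  where
  e : ∀ a x p q → a * q + (0ℤ + x * (p * q)) ≡ (a + x * p) * q
  e = solve-∀

eval-≈ₚ : ∀ p q → p ≈ₚ q → ∀ x → eval p x ≡ eval q x
eval-≈ₚ []      []      p≈q x = refl
eval-≈ₚ []      (b ∷ q) p≈q x =
  trans (sym (*-zeroʳ x)) (trans (cong (x *_) (eval-≈ₚ [] q (p≈q ∘ suc) x))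
    (trans (sym (+-identityˡ (x * eval q x))) (cong (_+ x * eval q x) (p≈q 0))))
eval-≈ₚ (a ∷ p) []      p≈q x =
  trans (cong₂ (λ s t → s + x * t) (p≈q 0) (eval-≈ₚ p [] (p≈q ∘ suc) x))
    (trans (+-identityˡ (x * 0ℤ)) (*-zeroʳ x))
eval-≈ₚ (a ∷ p) (b ∷ q) p≈q x = cong₂ (λ s t → s + x * t) (p≈q 0) (eval-≈ₚ p q (p≈q ∘ suc) x)

-- The sign used by det is local to its definition; the metavariable recovers
-- multiplication by it, by unification against the unfolded determinant.
mutual
  timesSign : ∀ n → (Fin (suc n) → Fin (suc n) → Poly) → Fin (suc n) → ℤ → ℤ
  timesSign zero    M j = 1ℤ *_
  timesSign (suc n) M j = _

  det-suc : ∀ n (M : Fin (suc n) → Fin (suc n) → Poly) → det (suc n) M ≡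
    List.foldr _+ₚ_ [] (List.map
      (λ j → List.map (timesSign n M j) (M zero j *ₚ det n (λ r c → M (suc r) (punchIn j c))))
      (allFin (suc n)))
  det-suc zero    M = refl
  det-suc (suc n) M = refl

timesSign≡alt : ∀ n M j y → timesSign n M j y ≡ alt j * y
timesSign≡alt zero                M zero             y = refl
timesSign≡alt (suc n)             M zero             y = refl
timesSign≡alt (suc n)             M (suc zero)       y = refl
timesSign≡alt (suc (suc zero))    M (suc (suc zero)) y = refl
-- The sign has period two, so the index drops by two; the zero matrix is a placeholder of the
-- smaller size.
timesSign≡alt (suc (suc (suc n))) M (suc (suc j))    y =
  trans (timesSign≡alt (suc n) (λ _ _ → []) j y) (cong (_* y) (sym (neg-involutive (alt j))))

eval-∑ : ∀ {A : Set} n (f : A → Poly) (g : Fin n → A) x →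
  eval (List.foldr _+ₚ_ [] (List.map f (tabulate g))) x ≡ sum (λ j → eval (f (g j)) x)
eval-∑ zero    f g x = refl
eval-∑ (suc n) f g x = trans (eval-+ₚ (f (g zero)) (List.foldr _+ₚ_ [] (List.map f (tabulate (g ∘ suc)))) x)
  (cong (λ t → eval (f (g zero)) x + t) (eval-∑ n f (g ∘ suc) x))

eval-det : ∀ n (M : Fin n → Fin n → Poly) x → eval (det n M) x ≡ ∣ (λ r c → eval (M r c) x) ∣ᴹ
eval-det zero    M x = e x
  where
  e : ∀ x → 1ℤ + x * 0ℤ ≡ 1ℤ
  e = solve-∀
eval-det (suc n) M x = trans (cong (λ p → eval p x) (det-suc n M)) (trans
  (eval-∑ (suc n) (λ j → List.map (timesSign n M j) (M zero j *ₚ minorDet j)) id x)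
  (sum-cong-≗ (λ j → trans
    (cong (λ p → eval p x) (map-cong (timesSign≡alt n M j) (M zero j *ₚ minorDet j)))
    (trans (eval-scaleₚ (alt j) (M zero j *ₚ minorDet j) x)
      (cong (alt j *_) (trans (eval-*ₚ (M zero j) (minorDet j) x)
        (cong (eval (M zero j) x *_) (eval-det n (λ r c → M (suc r) (punchIn j c)) x))))))))
  where
  minorDet : Fin (suc n) → Poly
  minorDet j = det n (λ r c → M (suc r) (punchIn j c))

δ-diagonal : ∀ {n} (u : Fin n) → δ u u ≡ 1ℤ
δ-diagonal zero    = refl
δ-diagonal (suc u) = δ-diagonal u

δ-off-diagonal : ∀ {n} {u v : Fin n} → u ≢ v → δ u v ≡ 0ℤ
δ-off-diagonal {u = zero}  {zero}  u≢v = contradiction refl u≢v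
δ-off-diagonal {u = zero}  {suc v} u≢v = refl
δ-off-diagonal {u = suc u} {zero}  u≢v = refl
δ-off-diagonal {u = suc u} {suc v} u≢v = δ-off-diagonal (u≢v ∘ cong suc)

δ-sym : ∀ {n} (u v : Fin n) → δ u v ≡ δ v u
δ-sym zero    zero    = refl
δ-sym zero    (suc v) = refl
δ-sym (suc u) zero    = refl
δ-sym (suc u) (suc v) = δ-sym u v

eval-charPoly : ∀ {n} (L : Matrix n) x → eval (charPoly L) x ≡ ∣ (λ u v → x * δ u v - L u v) ∣ᴹ
eval-charPoly {n} L x = trans (eval-det n _ x) (det-cong entry)
  where
  e₁ : ∀ x l → (0ℤ + x * (1ℤ + x * 0ℤ)) + (- l + x * 0ℤ) ≡ x * 1ℤ - l
  e₁ = solve-∀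
  e₂ : ∀ x l → - l + x * 0ℤ ≡ x * 0ℤ - l
  e₂ = solve-∀
  entry : ∀ u v → eval ((if does (u Fin.≟ v) then Xₚ else []) +ₚ constₚ (- L u v)) x ≡ x * δ u v - L u v
  entry u v with u Fin.≟ v
  ... | yes refl = trans (eval-+ₚ Xₚ (constₚ (- L u u)) x)
                     (trans (e₁ x (L u u)) (cong (λ t → x * t - L u u) (sym (δ-diagonal u))))
  ... | no u≢v   = trans (e₂ x (L u v)) (cong (λ t → x * t - L u v) (sym (δ-off-diagonal u≢v)))

-- From the characteristic polynomial to eigenvectors

module _ {n} (G : Graph n) where

  private L = laplacian G

  degree≡ : ∀ u → + degree G u ≡ sum (λ v → weight (adj G u v))
  degree≡ u = count n id
    where
    count : ∀ m (g : Fin m → Fin n) →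
      + List.foldr (λ v acc → if adj G u v then suc acc else acc) 0 (tabulate g) ≡ sum (λ v → weight (adj G u (g v)))
    count zero    g = refl
    count (suc m) g with adj G u (g zero)
    ... | true  = cong (λ t → 1ℤ + t) (count m (g ∘ suc))
    ... | false = trans (count m (g ∘ suc)) (sym (+-identityˡ _))

  laplacian≡ : ∀ u v → L u v ≡ + degree G u * δ u v - weight (adj G u v)
  laplacian≡ u v with u Fin.≟ v
  ... | yes refl rewrite irrefl G u | δ-diagonal u = e (+ degree G u)
    where
    e : ∀ x → x ≡ x * 1ℤ - 0ℤ
    e = solve-∀
  ... | no u≢v rewrite δ-off-diagonal u≢v with adj G u v
  ...   | true  = sym (cong (_- 1ℤ) (*-zeroʳ (+ degree G u)))
  ...   | false = sym (cong (_- 0ℤ) (*-zeroʳ (+ degree G u)))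

  laplacian-sym : ∀ u v → L u v ≡ L v u
  laplacian-sym u v with u Fin.≟ v | v Fin.≟ u
  ... | yes refl | yes _   = refl
  ... | yes refl | no u≢u  = contradiction refl u≢u
  ... | no u≢v   | yes v≡u = contradiction (sym v≡u) u≢v
  ... | no _     | no _    = cong (λ b → if b then -1ℤ else 0ℤ) (Graph.sym G u v)

  -- The degree is the sum of the weights at `u`, so the diagonal term spreads over the neighbours
  -- as copies of `z u`.
  laplacian-· : ∀ u z → L u · z ≡ sum (λ v → weight (adj G u v) * (z u - z v))
  laplacian-· u z = begin
    L u · z
      ≡⟨ sum-linear (+ degree G u) (λ v → trans (cong (_* z v) (laplacian≡ u v)) (e₁ (+ degree G u) (δ u v) (w v) (z v))) ⟩
    + degree G u * sum (λ v → z v * δ u v) + sum (λ v → - (w v * z v))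
      ≡⟨ cong₂ (λ s t → s * t + sum (λ v → - (w v * z v))) (degree≡ u)
           (trans (sum-cong-≗ (λ v → cong (z v *_) (δ-sym u v))) (sum-δ z u)) ⟩
    sum w * z u + sum (λ v → - (w v * z v))
      ≡⟨ cong (_+ sum (λ v → - (w v * z v))) (*-comm (sum w) (z u)) ⟩
    z u * sum w + sum (λ v → - (w v * z v))
      ≡⟨ sym (sum-linear (z u) (λ v → e₂ (w v) (z u) (z v))) ⟩
    sum (λ v → w v * (z u - z v)) ∎
    where
    open ≡-Reasoning
    w : Row n
    w v = weight (adj G u v)
    e₁ : ∀ d i w z → (d * i - w) * z ≡ d * (z * i) + - (w * z)
    e₁ = solve-∀
    e₂ : ∀ w x y → w * (x - y) ≡ x * w + - (w * y)
    e₂ = solve-∀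

  shifted-kernel⇒Eigen : ∀ x z → (∀ u → (λ v → x * δ u v - L u v) · z ≡ 0ℤ) → Eigen (adj G) x z
  shifted-kernel⇒Eigen x z Az≡0 = eigen λ u → begin
    sum (λ v → weight (adj G u v) * (z u - z v)) ≡⟨ sym (laplacian-· u z) ⟩
    L u · z ≡⟨ e₁ x (z u) (L u · z) ⟩
    x * z u + - (x * z u + -1ℤ * (L u · z)) ≡⟨ cong (λ t → x * z u + - t) (trans (sym (expand u)) (Az≡0 u)) ⟩
    x * z u + - 0ℤ ≡⟨ +-identityʳ (x * z u) ⟩
    x * z u ∎
    where
    open ≡-Reasoning
    e₁ : ∀ x z l → l ≡ x * z + - (x * z + -1ℤ * l)
    e₁ = solve-∀
    e₂ : ∀ x i l z → (x * i - l) * z ≡ x * (z * i) + -1ℤ * (l * z)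
    e₂ = solve-∀
    expand : ∀ u → (λ v → x * δ u v - L u v) · z ≡ x * z u + -1ℤ * (L u · z)
    expand u = trans (sum-linear x (λ v → e₂ x (δ u v) (L u v) (z v)))
      (cong₂ (λ s t → x * s + t) (trans (sum-cong-≗ (λ v → cong (z v *_) (δ-sym u v))) (sum-δ z u))
        (sym (*-distribˡ-sum -1ℤ (λ v → L u v * z v))))

  module _ s (spectrum : LaplacianSpectrumIs G s) where

    charDet : ∀ x → ∣ (λ u v → x * δ u v - L u v) ∣ᴹ ≡ eval (rootsPoly s) x
    charDet x = trans (sym (eval-charPoly L x)) (eval-≈ₚ (charPoly L) (rootsPoly s) spectrum x)

    eigenvector : ∀ x → eval (rootsPoly s) x ≡ 0ℤ → ∃ λ z → NonZeroRow z × Eigen (adj G) x z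
    eigenvector x root with kernel (λ u v → x * δ u v - L u v) (trans (charDet x) root)
    ... | z , z≢0 , Az≡0 = z , z≢0 , shifted-kernel⇒Eigen x z Az≡0

    -- Here symmetry turns algebraic into geometric multiplicity: a right kernel vector of `A` is
    -- also a left one, and `second-kernel-vector` finds another orthogonal to it.
    orthogonal-eigenvectors : ∀ x → (∀ t → ∃ λ q → eval (rootsPoly s) (x + t) ≡ t * (t * q)) →
      ∃ λ z → ∃ λ z′ → (NonZeroRow z × Eigen (adj G) x z) × (NonZeroRow z′ × Eigen (adj G) x z′) × z · z′ ≡ 0ℤ
    orthogonal-eigenvectors x double = pair (kernel A det≡0)
      where
      A : Matrix n
      A u v = x * δ u v - L u v
      -- The case `t = 0` of `double` says that `x` is a root.
      det≡0 : ∣ A ∣ᴹ ≡ 0ℤ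
      det≡0 with double 0ℤ
      ... | q , root = trans (charDet x) (trans (cong (eval (rootsPoly s)) (sym (+-identityʳ x))) root)
      A-sym : ∀ u v → A u v ≡ A v u
      A-sym u v = cong₂ (λ d l → x * d - l) (δ-sym u v) (laplacian-sym u v)
      e : ∀ x t d l → x * d - l + t * d ≡ (x + t) * d - l
      e = solve-∀
      double′ : ∀ t → ∃ λ q → ∣ (λ u v → A u v + t * δ u v) ∣ᴹ ≡ t * (t * q)
      double′ t with double t
      ... | q , root = q , trans (det-cong (λ u v → e x t (δ u v) (L u v))) (trans (charDet (x + t)) root)
      Pair = ∃ λ z → ∃ λ z′ → (NonZeroRow z × Eigen (adj G) x z) × (NonZeroRow z′ × Eigen (adj G) x z′) × z · z′ ≡ 0ℤ
      pair : Kernel A → Pair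
      pair (w , w≢0 , Aw≡0) = with-second (second-kernel-vector A w w≢0
          (λ c → trans (sum-cong-≗ (λ r → trans (*-comm (w r) (A r c)) (cong (_* w r) (A-sym r c)))) (Aw≡0 c))
          double′)
        where
        with-second : (∃ λ u → NonZeroRow u × (∀ r → A r · u ≡ 0ℤ) × w · u ≡ 0ℤ) → Pair
        with-second (z , z≢0 , Az≡0 , w·z≡0) =
          w , z , (w≢0 , shifted-kernel⇒Eigen x w Aw≡0) , (z≢0 , shifted-kernel⇒Eigen x z Az≡0) , w·z≡0

-- The roots listed by S

eval-rootsPoly-++ : ∀ s t x → eval (rootsPoly (s ++ t)) x ≡ eval (rootsPoly s) x * eval (rootsPoly t) x
eval-rootsPoly-++ []      t x = e x (eval (rootsPoly t) x)
  where
  e : ∀ x p → p ≡ (1ℤ + x * 0ℤ) * p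
  e = solve-∀
eval-rootsPoly-++ (a ∷ s) t x = trans (eval-*ₚ f (rootsPoly (s ++ t)) x)
  (trans (cong (eval f x *_) (eval-rootsPoly-++ s t x)) (trans
    (sym (*-assoc (eval f x) (eval (rootsPoly s) x) (eval (rootsPoly t) x)))
    (cong (_* eval (rootsPoly t) x) (sym (eval-*ₚ f (rootsPoly s) x)))))
  where f = Xₚ +ₚ constₚ (- (+ a))

-- Evaluation is multiplicative along `++`, so the block contributed by `a` can be pulled to the
-- front.
rootsPoly-concatMap : ∀ {A : Set} (f : A → List ℕ) {a} {as} → a ∈ as → ∀ x →
  ∃ λ q → eval (rootsPoly (concatMap f as)) x ≡ eval (rootsPoly (f a)) x * q
rootsPoly-concatMap f {a} {_ ∷ as} (here refl) x =
  eval (rootsPoly (concatMap f as)) x , eval-rootsPoly-++ (f a) (concatMap f as) x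
rootsPoly-concatMap f {a} {b ∷ as} (there a∈as) x with rootsPoly-concatMap f a∈as x
... | q , eq = eval (rootsPoly (f b)) x * q ,
  trans (eval-rootsPoly-++ (f b) (concatMap f as) x) (trans (cong (eval (rootsPoly (f b)) x *_) eq)
    (e (eval (rootsPoly (f b)) x) (eval (rootsPoly (f a)) x) q))
  where
  e : ∀ b a q → b * (a * q) ≡ a * (b * q)
  e = solve-∀

-- The function mapped by S is recovered in the same way.
mutual
  pick : ℕ → ℕ → ℕ → ℕ → ℕ → List ℕ
  pick = _

  S≡concatMap : ∀ n i j m → S n i j m ≡ concatMap (pick n i j m) (upTo (suc n))
  S≡concatMap n i j m = refl

≡ᵇ-false : ∀ {m n} → m ≢ n → (m ≡ᵇ n) ≡ false
≡ᵇ-false {m} {n} m≢n with m ≡ᵇ n in eq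
... | true  = contradiction (ℕ.≡ᵇ⇒≡ m n (subst T (sym eq) tt)) m≢n
... | false = refl

pick-single : ∀ {n i j m k} → k ≢ i → k ≢ j → k ≢ m → pick n i j m k ≡ k ∷ []
pick-single k≢i k≢j k≢m rewrite ≡ᵇ-false k≢i | ≡ᵇ-false k≢j | ≡ᵇ-false k≢m = refl

pick-double : ∀ {n i j m} → m ≢ i → m ≢ j → pick n i j m m ≡ m ∷ m ∷ []
pick-double {m = m} m≢i m≢j rewrite ≡ᵇ-false m≢i | ≡ᵇ-false m≢j with m ≡ᵇ m in eq
... | true  = refl
... | false = contradiction (subst T eq (ℕ.≡⇒≡ᵇ m m refl)) id

S-root : ∀ {n i j m k} → k ℕ.≤ n → k ≢ i → k ≢ j → k ≢ m → eval (rootsPoly (S n i j m)) (+ k) ≡ 0ℤ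
S-root {n} {i} {j} {m} {k} k≤n k≢i k≢j k≢m = vanish (rootsPoly-concatMap (pick n i j m) (∈-upTo⁺ (ℕ.s≤s k≤n)) (+ k))
  where
  e : ∀ x q → ((0ℤ + - x) + x * (1ℤ + x * 0ℤ)) * (1ℤ + x * 0ℤ) * q ≡ 0ℤ
  e = solve-∀
  vanish : (∃ λ q → eval (rootsPoly (S n i j m)) (+ k) ≡ eval (rootsPoly (pick n i j m k)) (+ k) * q) →
           eval (rootsPoly (S n i j m)) (+ k) ≡ 0ℤ
  vanish (q , eq) = trans eq (trans
    (cong (_* q) (trans (cong (λ l → eval (rootsPoly l) (+ k)) (pick-single {n} k≢i k≢j k≢m))
      (eval-*ₚ (Xₚ +ₚ constₚ (- (+ k))) (constₚ 1ℤ) (+ k))))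
    (e (+ k) q))

-- The block of `m` contributes two factors, each equal to `t` at `+ m + t`. Multiplicity is phrased
-- as divisibility by the square of the shift, the form that `orthogonal-eigenvectors` takes.
S-double-root : ∀ {n i j m} → m ℕ.≤ n → m ≢ i → m ≢ j →
  ∀ t → ∃ λ q → eval (rootsPoly (S n i j m)) (+ m + t) ≡ t * (t * q)
S-double-root {n} {i} {j} {m} m≤n m≢i m≢j t =
  factor (rootsPoly-concatMap (pick n i j m) (∈-upTo⁺ (ℕ.s≤s m≤n)) x)
  where
  x = + m + t
  f = Xₚ +ₚ constₚ (- (+ m))
  e : ∀ m t q → ((0ℤ + - m) + (m + t) * (1ℤ + (m + t) * 0ℤ)) *
                (((0ℤ + - m) + (m + t) * (1ℤ + (m + t) * 0ℤ)) * (1ℤ + (m + t) * 0ℤ)) * q ≡ t * (t * q)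
  e = solve-∀
  factor : (∃ λ q → eval (rootsPoly (S n i j m)) x ≡ eval (rootsPoly (pick n i j m m)) x * q) →
           ∃ λ q → eval (rootsPoly (S n i j m)) x ≡ t * (t * q)
  factor (q , eq) = q , trans eq (trans
    (cong (_* q) (trans (cong (λ l → eval (rootsPoly l) x) (pick-double {n} m≢i m≢j))
      (trans (eval-*ₚ f (f *ₚ constₚ 1ℤ) x) (cong (eval f x *_) (eval-*ₚ f (constₚ 1ℤ) x)))))
    (e (+ m) t q))

-- Excluding `j ≤ n - 3`

S-not-spectrum : ∀ k {i j} (G : Graph (4 ℕ.+ k)) → 2 ℕ.< i → i ℕ.< j → j ℕ.≤ 1 ℕ.+ k →
                 LaplacianSpectrumIs G (S (4 ℕ.+ k) i j 2) → ⊥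
S-not-spectrum k {i} {j} G 2<i i<j j≤1+k spectrum =
  double (orthogonal-eigenvectors G (S (4 ℕ.+ k) i j 2) spectrum (+ 2) (S-double-root {4 ℕ.+ k} {i} {j} 2≤4+k (ℕ.<⇒≢ 2<i) (ℕ.<⇒≢ (ℕ.<-trans 2<i i<j))))
  where
  2≤4+k : 2 ℕ.≤ 4 ℕ.+ k
  2≤4+k = ℕ.s≤s (ℕ.s≤s ℕ.z≤n)
  k≢0 : + k ≢ 0ℤ
  -- From `2 < i < j ≤ 1 + k` it follows that `2 < k`.
  k≢0 k≡0 = ℕ.n≮0 (subst (2 ℕ.<_) (+-injective k≡0)
    (ℕ.<-≤-trans 2<i (ℕ.s≤s⁻¹ (ℕ.≤-trans i<j j≤1+k))))
  H = complement (adj G)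
  co-eigenvalue : ∀ {μ ν} → μ ≢ 0ℤ → + (4 ℕ.+ k) - μ ≡ ν →
                  (∃ λ z → NonZeroRow z × Eigen (adj G) μ z) → Eigenvalue H ν
  co-eigenvalue {μ} μ≢0 refl (z , z≢0 , z-eig) =
    z , z≢0 , z-sum , eigen-complement z-sum z-eig
    where
    z-sum : sum z ≡ 0ℤ
    z-sum = eigen-sum (Graph.sym G) μ≢0 z-eig
  root : ∀ {l ν} → l ℕ.≤ 4 ℕ.+ k → l ≢ i → l ≢ j → l ≢ 2 → + l ≢ 0ℤ → + (4 ℕ.+ k) - + l ≡ ν → Eigenvalue H ν
  root {l} l≤n l≢i l≢j l≢2 l≢0 eq =
    co-eigenvalue l≢0 eq (eigenvector G (S (4 ℕ.+ k) i j 2) spectrum (+ l) (S-root {4 ℕ.+ k} {i} {j} l≤n l≢i l≢j l≢2))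
  -- The indices `l = 2, 1, 0` stand for the roots `n`, `n - 1`, `n - 2`; they all exceed `j`, so
  -- none of them has been removed.
  large-root : ∀ {l ν} → l ℕ.≤ 2 → + (4 ℕ.+ k) - + (2 ℕ.+ l ℕ.+ k) ≡ ν → Eigenvalue H ν
  large-root {l} l≤2 = root (ℕ.+-monoˡ-≤ k (ℕ.+-monoʳ-≤ 2 l≤2))
    (ℕ.>⇒≢ (ℕ.<-trans i<j j<)) (ℕ.>⇒≢ j<) (ℕ.>⇒≢ (ℕ.<-trans 2<i (ℕ.<-trans i<j j<))) (λ ())
    where
    j< : j ℕ.< 2 ℕ.+ l ℕ.+ k
    j< = ℕ.≤-trans (ℕ.s≤s j≤1+k) (ℕ.+-monoˡ-≤ k (ℕ.m≤m+n 2 l))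
  difference₁ : ∀ k → (+ 4 + k) - (+ 3 + k) ≡ 1ℤ
  difference₁ = solve-∀
  difference₂ : ∀ k → (+ 4 + k) - (+ 2 + k) ≡ + 2
  difference₂ = solve-∀
  sum₂ : ∀ {z} → Eigen (adj G) (+ 2) z → sum z ≡ 0ℤ
  sum₂ = eigen-sum (Graph.sym G) (λ ())
  double : (∃ λ z → ∃ λ z′ → (NonZeroRow z × Eigen (adj G) (+ 2) z) ×
             (NonZeroRow z′ × Eigen (adj G) (+ 2) z′) × z · z′ ≡ 0ℤ) → ⊥
  double (z , z′ , (z≢0 , z-eig) , (z′≢0 , z′-eig) , z·z′≡0) =
    rigid⇒not-orthogonal rigid z≢0 (sum₂ z-eig) (eigen-complement (sum₂ z-eig) z-eig)
      z′≢0 (sum₂ z′-eig) (eigen-complement (sum₂ z′-eig) z′-eig) z·z′≡0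
    where
    -- The roots `n`, `1`, `n - 1`, `2`, `n - 2` of `G` become, in this order, the eigenvalues `0`,
    -- `3 + k`, `1`, `2 + k`, `2` of `H`; rigidity at `2 + k` concerns the root 2 of `G`.
    rigid : Rigid H (+ (2 ℕ.+ k))
    rigid = rigid₄ k≢0 (λ u v → cong not (Graph.sym G u v))
      (large-root {2} ℕ.≤-refl (+-inverseʳ (+ (4 ℕ.+ k))))
      (root {1} (ℕ.s≤s ℕ.z≤n) (ℕ.<⇒≢ 1<i) (ℕ.<⇒≢ (ℕ.<-trans 1<i i<j)) (λ ()) (λ ()) refl)
      (large-root {1} (ℕ.s≤s ℕ.z≤n) (difference₁ (+ k)))
      (co-eigenvalue (λ ()) refl (z , z≢0 , z-eig))
      (large-root {0} ℕ.z≤n (difference₂ (+ k)))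
      where
      1<i : 1 ℕ.< i
      1<i = ℕ.<-trans (ℕ.n<1+n 1) 2<i

theorem4p1 : (n i j : ℕ) → (G : Graph n) →
    0 ℕ.< i → i ℕ.< j → j ℕ.≤ n → 2 ℕ.≤ n → i ≢ 2 → j ≢ 2 →
    Realizes G (S n i j 2) →
    1 ℕ.< i → n ℕ.< j ℕ.+ 3
theorem4p1 n i j G _ i<j _ _ i≢2 _ (_ , spectrum) 1<i = ℕ.≰⇒> λ j+3≤n →
  excluded G spectrum (ℕ.m≤n⇒∃[o]m+o≡n (4≤n j+3≤n)) j+3≤n
  where
  2<i : 2 ℕ.< i
  2<i = ℕ.≤∧≢⇒< 1<i (i≢2 ∘ sym)
  4≤n : j ℕ.+ 3 ℕ.≤ n → 4 ℕ.≤ n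
  4≤n = ℕ.≤-trans (ℕ.+-monoˡ-≤ 3 (ℕ.≤-trans (ℕ.s≤s ℕ.z≤n) i<j))
  -- The order is abstracted together with the graph, so that matching on the equation turns `G`
  -- into a graph on `4 + k` vertices.
  excluded : ∀ {n} (G : Graph n) → LaplacianSpectrumIs G (S n i j 2) → (∃ λ k → 4 ℕ.+ k ≡ n) → j ℕ.+ 3 ℕ.≤ n → ⊥
  excluded G spectrum (k , refl) j+3≤n = S-not-spectrum k G 2<i i<j
    (ℕ.+-cancelˡ-≤ 3 j (1 ℕ.+ k) (subst (ℕ._≤ 4 ℕ.+ k) (ℕ.+-comm j 3) j+3≤n)) spectrum
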